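{- Let $n=2m$ be an even positive integer. Let $\{a[i,j]\}$, $\{b[i,j]\}$, $\{z[i,j]\}$ ($1\le i,j\le n$) be three independent families of Plücker indeterminates, and work in the field of fractions of the ring they generate. Let $\mathfrak S_n$ act on the $a$'s and $z$'s simultaneously by $\sigma\cdot a[i,j]=a[\sigma(i),\sigma(j)]$, $\sigma\cdot z[i,j]=z[\sigma(i),\sigma(j)]$ (fixing the $b$'s), and put $\nabla^{az}=\frac{1}{n!}\sum_{\sigma\in\mathfrak S_n}\mathrm{sgn}(\sigma)\,\sigma$ for this action; define $\nabla^{bz}$ in the same way with $b$ in place of $a$ (fixing the $a$'s). Put $$P_a=\prod_{k=1}^m a[k,m+k]\cdot\prod_{1\le i<j\le m}z[i,j]\cdot\prod_{m+1\le i<j\le n}z[i,j],\qquad P_b=\prod_{k=1}^m b[k,m+k]\cdot\prod_{1\le i<j\le m}z[i,j]\cdot\prod_{m+1\le i<j\le n}z[i,j].$$ Let $d=\frac{(2m)!}{m!\,(m+1)!}$ (the number of standard Young tableaux of shape $[m,m]$). Then the Pfaffian of the $n\times n$ antisymmetric matrix with off-diagonal entries $a[i,j]\,b[i,j]/z[i,j]$ and zero diagonal satisfies $$\mathrm{Pf}\left(\frac{a[i,j]\,b[i,j]}{z[i,j]}\right)_{1\le i,j\le n}=\frac{d^2}{\prod_{1\le i<j\le n}z[i,j]}\,\bigl(\nabla^{az}P_a\bigr)\bigl(\nabla^{bz}P_b\bigr).$$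
   Context: A family of Plücker indeterminates $\{z[i,j]\}_{1\le i,j\le n}$ consists of indeterminates with $z[i,j]=-z[j,i]$ (for $i\neq j$), subject only to the Plücker relations $z[i,j]z[k,l]-z[i,k]z[j,l]+z[j,k]z[i,l]=0$ for all quadruples of distinct indices (i.e. they generate the coordinate ring of the Grassmannian of 2-planes, a domain). $\mathrm{sgn}(\sigma)=(-1)^{\ell(\sigma)}$ is the sign of the permutation. -}

module Defs where

open import Level using (Level)
open import Algebra.Bundles using (CommutativeRing)
open import Data.Bool using (Bool; true; false; if_then_else_; _∧_; not)
open import Data.Nat as ℕ using (ℕ; zero; suc; _+_; _*_; _!; _<ᵇ_; _<_; _≤_; s≤s)
open import Data.Nat.Properties using (_!*_!≢0; +-mono-≤; +-suc)
open import Data.Fin as Fin using (Fin; toℕ; fromℕ<; _↑ˡ_; _↑ʳ_)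
open import Data.Fin.Properties using (toℕ<n)
open import Data.List using (List; []; _∷_; map; foldr; concatMap; filterᵇ; allFin; length)
open import Data.Bool.ListAction using (and)
open import Data.Product using (_×_; _,_; proj₁; proj₂)
open import Relation.Nullary using (does; ¬_)
open import Relation.Binary.PropositionalEquality using (_≡_; subst; sym)

consF : ∀ {k n} → Fin n → (Fin k → Fin n) → Fin (suc k) → Fin n
consF i f Fin.zero    = i
consF i f (Fin.suc j) = f j

allFuns : (k n : ℕ) → List (Fin k → Fin n)
allFuns zero    n = (λ ()) ∷ []
allFuns (suc k) n = concatMap (λ i → map (consF i) (allFuns k n)) (allFin n)

pairsLt : (n : ℕ) → List (Fin n × Fin n)
pairsLt n = concatMap (λ i → map (i ,_) (filterᵇ (λ j → toℕ i <ᵇ toℕ j) (allFin n))) (allFin n)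

injectiveᵇ : ∀ {n} → (Fin n → Fin n) → Bool
injectiveᵇ {n} f = and (map (λ p → not (does (f (proj₁ p) Fin.≟ f (proj₂ p)))) (pairsLt n))

Perms : (n : ℕ) → List (Fin n → Fin n)
Perms n = filterᵇ injectiveᵇ (allFuns n n)

inversions : ∀ {n} → (Fin n → Fin n) → ℕ
inversions {n} σ = length (filterᵇ (λ p → toℕ (σ (proj₂ p)) <ᵇ toℕ (σ (proj₁ p))) (pairsLt n))

private
  bound : ∀ {m k} → k < m → suc (k + k) < m + m
  bound {m} {k} k<m = subst (_≤ m + m) (+-suc (suc k) k) (+-mono-≤ k<m k<m)

  bound′ : ∀ {m k} → k < m → k + k < m + m
  bound′ {m} {k} k<m = ℕ.<-trans ℕ.≤-refl (bound k<m)
    where import Data.Nat.Properties as ℕ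

evenPos : ∀ {m} → Fin m → Fin (m + m)
evenPos k = fromℕ< (bound′ (toℕ<n k))

oddPos : ∀ {m} → Fin m → Fin (m + m)
oddPos k = fromℕ< (bound (toℕ<n k))

-- σ corresponds to a perfect matching in standard form:
-- σ(2k) < σ(2k+1) for all k and σ(0) < σ(2) < ... < σ(2m-2)
isMatchingPerm : ∀ m → (Fin (m + m) → Fin (m + m)) → Bool
isMatchingPerm m σ =
  and (map (λ k → toℕ (σ (evenPos k)) <ᵇ toℕ (σ (oddPos k))) (allFin m))
  ∧ and (map (λ p → toℕ (σ (evenPos (proj₁ p))) <ᵇ toℕ (σ (evenPos (proj₂ p)))) (pairsLt m))

-- d = (2m)! / (m! (m+1)!)   (number of SYT of shape [m,m])
dSYT : ℕ → ℕ
dSYT m = ((m + m) ! ℕ./ (m ! * (suc m) !)) {{m !* suc m !≢0}}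

module RingDefs {c ℓ : Level} (R : CommutativeRing c ℓ) where
  open CommutativeRing R using (Carrier; _≈_; 0#; 1#; -_) renaming (_+_ to _+R_; _*_ to _*R_)

  sumR : List Carrier → Carrier
  sumR = foldr _+R_ 0#

  prodR : List Carrier → Carrier
  prodR = foldr _*R_ 1#

  fromℕR : ℕ → Carrier
  fromℕR zero    = 0#
  fromℕR (suc k) = 1# +R fromℕR k

  negOnePow : ℕ → Carrier
  negOnePow zero    = 1#
  negOnePow (suc k) = - negOnePow k

  sgn : ∀ {n} → (Fin n → Fin n) → Carrier
  sgn σ = negOnePow (inversions σ)

  record IsPlücker {n : ℕ} (x : Fin n → Fin n → Carrier) : Set (c Level.⊔ ℓ) where
    field
      antisym : ∀ i j → ¬ (i ≡ j) → x i j ≈ - x j i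
      plücker : ∀ i j k l → ¬ (i ≡ j) → ¬ (i ≡ k) → ¬ (i ≡ l) → ¬ (j ≡ k) → ¬ (j ≡ l) → ¬ (k ≡ l) →
                x i j *R x k l +R - (x i k *R x j l) +R x j k *R x i l ≈ 0#

  -- Pfaffian of a (2m)×(2m) matrix: sum over perfect matchings
  -- {(i₁,j₁),…,(i_m,j_m)}, i_k < j_k, i₁ < … < i_m, of sgn · ∏ A[i_k,j_k]
  Pf : ∀ m → (Fin (m + m) → Fin (m + m) → Carrier) → Carrier
  Pf m A = sumR (map (λ σ → sgn σ *R prodR (map (λ k → A (σ (evenPos k)) (σ (oddPos k))) (allFin m)))
                       (filterᵇ (isMatchingPerm m) (Perms (m + m))))

  -- the antisymmetriser  (1/n!) Σ_σ sgn(σ) σ  acting simultaneously on the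
  -- two families x, z (σ·x[i,j] = x[σ i, σ j]) of an expression F(x, z);
  -- `nInv` is the inverse of n! in R
  ∇ : ∀ {n} → Carrier → ((Fin n → Fin n → Carrier) → (Fin n → Fin n → Carrier) → Carrier)
      → (Fin n → Fin n → Carrier) → (Fin n → Fin n → Carrier) → Carrier
  ∇ {n} nInv F x z = nInv *R sumR (map (λ σ → sgn σ *R F (λ i j → x (σ i) (σ j)) (λ i j → z (σ i) (σ j))) (Perms n))

  P : (m : ℕ) → (Fin (m + m) → Fin (m + m) → Carrier) → (Fin (m + m) → Fin (m + m) → Carrier) → Carrier
  P m x z = prodR (map (λ k → x (k ↑ˡ m) (m ↑ʳ k)) (allFin m))
          *R prodR (map (λ p → z (proj₁ p ↑ˡ m) (proj₂ p ↑ˡ m)) (pairsLt m))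
          *R prodR (map (λ p → z (m ↑ʳ proj₁ p) (m ↑ʳ proj₂ p)) (pairsLt m))

{-# OPTIONS --safe #-}
-- Divide by ∏_{i<j} z[i,j]. As this product is alternating, every sign disappears: ∇P_a becomes
-- S_a(N) / n!, where S_a(N) is the sum over all orderings p₁ q₁ … p_m q_m of the index set N of
-- ∏ a[p_k,q_k] / ∏_{k,l} z[p_k,q_l], and the Pfaffian becomes a signless sum Q(N) over perfect
-- matchings. What has to be shown is (m! (m+1)!)² Q(N) = S_a(N) S_b(N).
--
-- Expand Q along an index n, Q(N) = Σ_i a[i,n] b[i,n] (…) Q(N ∖ {i,n}), and use induction. The Plücker
-- relations for b turn (m+1) b[i,n] ∏ b[p_k,q_k], summed over orderings, into twice the sum of
-- b[p,n] ∏ b[p_k,q_k] over the exchanges of i with p and the p_k. The remaining sum over i has the form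
-- Σ_i a[i,n] S_a(N ∖ {i,n}) / z[i,n] / ∏_l z[i,l], with l running over half of the indices, and equals
-- S_a(N) up to a known factor: the same exchange applied to a reduces this to the vanishing
-- Σ_i ∏_{j ∈ J} z[i,j] / ∏_{l ∈ T ∖ i} z[i,l] = 0 of partial fractions for |J| = |T| - 2.
module Submission where

open import Defs
open import Level using (Level)
open import Algebra.Bundles using (CommutativeRing)
import Algebra.Properties.Ring as RingProperties
import Algebra.Properties.Semiring.Mult as SemiringMult
import Algebra.Solver.Ring as RingSolver
open import Algebra.Solver.Ring.AlmostCommutativeRing
  using (fromCommutativeRing; _-Raw-AlmostCommutative⟶_; Induced-equivalence)
open import Data.Bool using (Bool; true; false; if_then_else_; _∧_; not; T)
open import Data.Bool.ListAction using (and)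
open import Data.Bool.Properties using (∧-assoc; T-∧)
open import Data.Empty using (⊥-elim)
import Data.Fin
open import Data.Fin as Fin using (Fin; toℕ; _↑ˡ_; _↑ʳ_)
import Data.Fin.Properties as Fin
import Data.Integer as ℤ
import Data.Integer.Properties as ℤ
open import Data.List
  using (List; []; _∷_; _++_; length; map; concatMap; filterᵇ; allFin; tabulate; zipWith; take; drop)
open import Data.List.Properties
  using (map-∘; map-++; map-concatMap; concatMap-map; concatMap-cong; map-tabulate; tabulate-cong;
         length-map; length-tabulate; take++drop≡id)
open import Data.List.Relation.Binary.Permutation.Propositional as Perm
  using (_↭_; ↭-refl; ↭-sym; ↭-trans; prep; swap)
open import Data.List.Relation.Binary.Permutation.Propositional.Properties
  using (↭-length; shift; ++⁺ʳ; All-resp-↭)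
open import Data.List.Relation.Binary.Permutation.Setoid.Properties using (Unique-resp-↭)
open import Data.List.Relation.Unary.All as All using (All; []; _∷_)
import Data.List.Relation.Unary.All.Properties as All
open import Data.List.Relation.Unary.AllPairs as AllPairs using (AllPairs; []; _∷_)
import Data.List.Relation.Unary.AllPairs.Properties as AllPairs
open import Data.List.Relation.Unary.Unique.Propositional using (Unique)
import Data.Maybe as Maybe
open import Data.Nat as ℕ using (ℕ; zero; suc; _≤_; _!; _<ᵇ_)
open import Data.Nat.Combinatorics using (k![n∸k]!∣n!)
open import Data.Nat.Divisibility using (_∣_; divides; 1∣_)
open import Data.Nat.DivMod using (m/n*n≡m)
import Data.Nat.Properties as ℕ
import Data.Nat.Solver as ℕ-Solver
open import Data.Product as Product using (_×_; _,_; proj₁; proj₂; uncurry)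
open import Function using (_∘_; id; Equivalence)
open import Relation.Binary.Definitions using (WeaklyDecidable; tri<; tri≈; tri>)
open import Relation.Binary.PropositionalEquality as ≡ using (_≡_; _≢_)
import Relation.Binary.Reasoning.Setoid as SetoidReasoning
open import Relation.Nullary using (Dec; does; ¬_; yes; no)
open import Relation.Nullary.Decidable using (dec⇒maybe; dec-true; dec-false)

-- After the expansion, `i` enters a summand through `a[i,n]`, through `b[i,n]` and through the
-- index set left to both sums, so the product of the `a`-sum and the `b`-sum does not separate term
-- by term. The exchange frees the `b`-part from `i`: inside a sum over all words it is an
-- involution, so it can be moved from the product of the `b`'s onto the remaining weight, and what
-- still depends on `i` involves only `a` and `z`. With k pairs left, each pair contributes one copy
-- of the product and the word and its flip contribute one unexchanged copy each, whence the factor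
-- k + 2; the flip is also the origin of the factor two. The degree condition of the partial
-- fractions is met exactly: T holds `n`, the exchanged letter and the k first entries of a word for
-- `a`, while J holds the k second entries of a word for `b`. An induction step costs (k + 1)(k + 2)
-- for `a` and again for `b`, where k + 1 counts the positions of the pair containing `n`. Over all
-- steps this gives m! (m+1)! twice, and d · m! (m+1)! = (2m)! is what the factor 1/n! of each
-- antisymmetriser cancels.

-- Ring solver with integer coefficients

module IntegerSolver {c ℓ : Level} (R : CommutativeRing c ℓ) where
  open CommutativeRing R
  open RingProperties ring using (-0#≈0#; -‿+-comm; -‿distribˡ-*; -‿distribʳ-*; -‿involutive)
  open SemiringMult semiring using (×-homo-+; ×1-homo-*; ×-homo-1) renaming (_×_ to _·_)
  open SetoidReasoning setoid

  fromℤ : ℤ.ℤ → Carrier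
  fromℤ (ℤ.+ n)      = n · 1#
  fromℤ (ℤ.-[1+ n ]) = - (suc n · 1#)

  fromℤ-neg : ∀ i → fromℤ (ℤ.- i) ≈ - fromℤ i
  fromℤ-neg (ℤ.+ zero)     = sym -0#≈0#
  fromℤ-neg (ℤ.+ (suc n))  = refl
  fromℤ-neg (ℤ.-[1+ n ])   = sym (-‿involutive _)

  fromℤ-⊖ : ∀ m n → fromℤ (m ℤ.⊖ n) ≈ m · 1# - n · 1#
  fromℤ-⊖ m       zero    = sym (trans (+-congˡ -0#≈0#) (+-identityʳ _))
  fromℤ-⊖ zero    (suc n) = sym (+-identityˡ _)
  fromℤ-⊖ (suc m) (suc n) = begin
    fromℤ (suc m ℤ.⊖ suc n)               ≡⟨ ≡.cong fromℤ (ℤ.[1+m]⊖[1+n]≡m⊖n m n) ⟩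
    fromℤ (m ℤ.⊖ n)                       ≈⟨ fromℤ-⊖ m n ⟩
    m · 1# - n · 1#                       ≈⟨ +-identityˡ _ ⟨
    0# + (m · 1# - n · 1#)                ≈⟨ +-congʳ (-‿inverseʳ 1#) ⟨
    (1# - 1#) + (m · 1# - n · 1#)         ≈⟨ +-assoc _ _ _ ⟩
    1# + (- 1# + (m · 1# - n · 1#))       ≈⟨ +-congˡ (+-assoc _ _ _) ⟨
    1# + (- 1# + m · 1# - n · 1#)         ≈⟨ +-congˡ (+-congʳ (+-comm _ _)) ⟩
    1# + (m · 1# - 1# - n · 1#)           ≈⟨ +-congˡ (+-assoc _ _ _) ⟩
    1# + (m · 1# + (- 1# - n · 1#))       ≈⟨ +-assoc _ _ _ ⟨
    (1# + m · 1#) + (- 1# - n · 1#)       ≈⟨ +-congˡ (-‿+-comm _ _) ⟩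
    suc m · 1# - suc n · 1#               ∎

  fromℤ-+ : ∀ i j → fromℤ (i ℤ.+ j) ≈ fromℤ i + fromℤ j
  fromℤ-+ (ℤ.+ m)      (ℤ.+ n)      = ×-homo-+ 1# m n
  fromℤ-+ (ℤ.+ m)      (ℤ.-[1+ n ]) = fromℤ-⊖ m (suc n)
  fromℤ-+ (ℤ.-[1+ m ]) (ℤ.+ n)      = trans (fromℤ-⊖ n (suc m)) (+-comm _ _)
  fromℤ-+ (ℤ.-[1+ m ]) (ℤ.-[1+ n ]) = begin
    - ((suc (suc (m ℕ.+ n))) · 1#)       ≈⟨ -‿cong (+-congˡ (×-homo-+ 1# (suc m) n)) ⟩
    - (1# + (suc m · 1# + n · 1#))       ≈⟨ -‿cong (+-assoc _ _ _) ⟨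
    - (1# + suc m · 1# + n · 1#)         ≈⟨ -‿cong (+-congʳ (+-comm _ _)) ⟩
    - (suc m · 1# + 1# + n · 1#)         ≈⟨ -‿cong (+-assoc _ _ _) ⟩
    - (suc m · 1# + suc n · 1#)          ≈⟨ -‿+-comm _ _ ⟨
    - (suc m · 1#) - suc n · 1#          ∎

  fromℤ-pos-* : ∀ m j → fromℤ (ℤ.+ m ℤ.* j) ≈ m · 1# * fromℤ j
  fromℤ-pos-* m (ℤ.+ n)      = trans (reflexive (≡.cong fromℤ (≡.sym (ℤ.pos-* m n)))) (×1-homo-* m n)
  fromℤ-pos-* m (ℤ.-[1+ n ]) = begin
    fromℤ (ℤ.+ m ℤ.* ℤ.-[1+ n ])          ≡⟨ ≡.cong fromℤ (ℤ.neg-distribʳ-* (ℤ.+ m) (ℤ.+ suc n)) ⟨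
    fromℤ (ℤ.- (ℤ.+ m ℤ.* (ℤ.+ suc n)))   ≈⟨ fromℤ-neg (ℤ.+ m ℤ.* (ℤ.+ suc n)) ⟩
    - fromℤ (ℤ.+ m ℤ.* (ℤ.+ suc n))       ≈⟨ -‿cong (fromℤ-pos-* m (ℤ.+ suc n)) ⟩
    - (m · 1# * (suc n · 1#))             ≈⟨ -‿distribʳ-* _ _ ⟩
    m · 1# * - (suc n · 1#)               ∎

  fromℤ-* : ∀ i j → fromℤ (i ℤ.* j) ≈ fromℤ i * fromℤ j
  fromℤ-* (ℤ.+ m)      j = fromℤ-pos-* m j
  fromℤ-* (ℤ.-[1+ m ]) j = begin
    fromℤ (ℤ.-[1+ m ] ℤ.* j)              ≡⟨ ≡.cong fromℤ (ℤ.neg-distribˡ-* (ℤ.+ suc m) j) ⟨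
    fromℤ (ℤ.- ((ℤ.+ suc m) ℤ.* j))       ≈⟨ fromℤ-neg ((ℤ.+ suc m) ℤ.* j) ⟩
    - fromℤ ((ℤ.+ suc m) ℤ.* j)           ≈⟨ -‿cong (fromℤ-pos-* (suc m) j) ⟩
    - (suc m · 1# * fromℤ j)              ≈⟨ -‿distribˡ-* _ _ ⟩
    - (suc m · 1#) * fromℤ j              ∎

  -- Equality in `R` is not assumed decidable. Coefficients from ℤ, where it is, let the solver
  -- recognise that terms cancel.
  morphism : CommutativeRing.rawRing ℤ.+-*-commutativeRing -Raw-AlmostCommutative⟶ fromCommutativeRing R
  morphism = record
    { ⟦_⟧    = fromℤ
    ; +-homo = fromℤ-+
    ; *-homo = fromℤ-*
    ; -‿homo = fromℤ-neg
    ; 0-homo = refl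
    ; 1-homo = ×-homo-1 1#
    }

  coefficients≟ : WeaklyDecidable (Induced-equivalence morphism)
  coefficients≟ i j = Maybe.map (λ i≡j → reflexive (≡.cong fromℤ i≡j)) (dec⇒maybe (i ℤ.≟ j))

  open RingSolver (CommutativeRing.rawRing ℤ.+-*-commutativeRing) (fromCommutativeRing R) morphism coefficients≟ public
    using (solve; _:=_; _:+_; _:*_; _:-_; :-_; con)

-- Sums over picks, arrangements and exchanges

-- Unlike `m + m`, this exposes two successors at each step, so that a recursion can remove a whole
-- pair.
double : ℕ → ℕ
double zero    = zero
double (suc n) = suc (suc (double n))

module _ {e : Level} {E : Set e} where
  insertAt : ℕ → E → List E → List E
  insertAt zero    x w       = x ∷ w
  insertAt (suc j) x []      = x ∷ []
  insertAt (suc j) x (y ∷ w) = y ∷ insertAt j x w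

module Arrangements {c ℓ : Level} (R : CommutativeRing c ℓ) {e : Level} (E : Set e) where
  open CommutativeRing R
  open IntegerSolver R
  open SetoidReasoning setoid

  Σpick : List E → (E → List E → Carrier) → Carrier
  Σpick []       F = 0#
  Σpick (x ∷ xs) F = F x xs + Σpick xs (λ y ys → F y (x ∷ ys))

  Σarr : ℕ → List E → (List E → Carrier) → Carrier
  Σarr zero    xs f = f []
  Σarr (suc k) xs f = Σpick xs (λ x ys → Σarr k ys (λ w → f (x ∷ w)))

  Σpick-cong-↭ : ∀ xs {F G} → (∀ y ys → y ∷ ys ↭ xs → F y ys ≈ G y ys) → Σpick xs F ≈ Σpick xs G
  Σpick-cong-↭ []       h = refl
  Σpick-cong-↭ (x ∷ xs) h = +-cong (h x xs ↭-refl)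
    (Σpick-cong-↭ xs (λ y ys p → h y (x ∷ ys) (↭-trans (swap y x ↭-refl) (prep x p))))

  Σpick-cong-AllPairs : ∀ {s} {S : E → E → Set s} {xs F G} → AllPairs S xs →
    (∀ y ys → y ∷ ys ↭ xs → AllPairs S ys → F y ys ≈ G y ys) → Σpick xs F ≈ Σpick xs G
  Σpick-cong-AllPairs []       h = refl
  Σpick-cong-AllPairs {xs = x ∷ xs} (p ∷ ps) h = +-cong (h x xs ↭-refl ps)
    (Σpick-cong-AllPairs ps (λ y ys q qs → h y (x ∷ ys) (↭-trans (swap y x ↭-refl) (prep x q))
      (All.tail (All-resp-↭ (↭-sym q) p) ∷ qs)))

  Σpick-cong : ∀ xs {F G} → (∀ y ys → F y ys ≈ G y ys) → Σpick xs F ≈ Σpick xs G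
  Σpick-cong xs h = Σpick-cong-↭ xs (λ y ys _ → h y ys)

  Σpick-zero : ∀ xs {F} → (∀ y ys → F y ys ≈ 0#) → Σpick xs F ≈ 0#
  Σpick-zero []       h = refl
  Σpick-zero (x ∷ xs) h = trans (+-cong (h _ _) (Σpick-zero xs (λ y ys → h y _))) (+-identityˡ _)

  Σpick-+ : ∀ xs F G → Σpick xs (λ y ys → F y ys + G y ys) ≈ Σpick xs F + Σpick xs G
  Σpick-+ []       F G = sym (+-identityˡ _)
  Σpick-+ (x ∷ xs) F G = trans (+-congˡ (Σpick-+ xs _ _))
    (solve 4 (λ a b c d → (a :+ b) :+ (c :+ d) := (a :+ c) :+ (b :+ d)) refl _ _ _ _)

  Σpick-*ˡ : ∀ t xs F → Σpick xs (λ y ys → t * F y ys) ≈ t * Σpick xs F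
  Σpick-*ˡ t []       F = sym (zeroʳ t)
  Σpick-*ˡ t (x ∷ xs) F = trans (+-congˡ (Σpick-*ˡ t xs _)) (sym (distribˡ t _ _))

  -- A pick keeps the order of the remaining elements, so both orders of removal end in the
  -- identical list `zs`, and the two picked elements merely trade names.
  Σpick-Σpick-comm : ∀ xs (G : E → E → List E → Carrier) →
    Σpick xs (λ x ys → Σpick ys (λ y zs → G x y zs)) ≈ Σpick xs (λ x ys → Σpick ys (λ y zs → G y x zs))
  Σpick-Σpick-comm []       G = refl
  Σpick-Σpick-comm (x ∷ xs) G = begin
    Σpick xs (G x) + Σpick xs (λ y ys → G y x ys + Σpick ys (λ z zs → G y z (x ∷ zs)))
      ≈⟨ +-congˡ (Σpick-+ xs _ _) ⟩
    Σpick xs (G x) + (Σpick xs (λ y ys → G y x ys) + Σpick xs (λ y ys → Σpick ys (λ z zs → G y z (x ∷ zs))))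
      ≈⟨ +-congˡ (+-congˡ (Σpick-Σpick-comm xs (λ y z zs → G y z (x ∷ zs)))) ⟩
    Σpick xs (G x) + (Σpick xs (λ y ys → G y x ys) + Σpick xs (λ y ys → Σpick ys (λ z zs → G z y (x ∷ zs))))
      ≈⟨ solve 3 (λ a b c → a :+ (b :+ c) := b :+ (a :+ c)) refl _ _ _ ⟩
    Σpick xs (λ y ys → G y x ys) + (Σpick xs (G x) + Σpick xs (λ y ys → Σpick ys (λ z zs → G z y (x ∷ zs))))
      ≈⟨ +-congˡ (Σpick-+ xs _ _) ⟨
    Σpick xs (λ y ys → G y x ys) + Σpick xs (λ y ys → G x y ys + Σpick ys (λ z zs → G z y (x ∷ zs))) ∎

  Σpick-rotate : ∀ xs (G : E → E → E → List E → Carrier) →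
    Σpick xs (λ x ys → Σpick ys (λ y zs → Σpick zs (λ z ws → G x y z ws))) ≈
    Σpick xs (λ x ys → Σpick ys (λ y zs → Σpick zs (λ z ws → G z x y ws)))
  Σpick-rotate xs G = trans
    (Σpick-Σpick-comm xs (λ x y zs → Σpick zs (G x y)))
    (Σpick-cong xs (λ x ys → Σpick-Σpick-comm ys (λ y z ws → G y x z ws)))

  Σpick-↭ : ∀ {xs ys F} → (∀ z {us vs} → us ↭ vs → F z us ≈ F z vs) → xs ↭ ys → Σpick xs F ≈ Σpick ys F
  Σpick-↭ h Perm.refl        = refl
  Σpick-↭ h (prep x p)       = +-cong (h x p) (Σpick-↭ (λ z q → h z (prep x q)) p)
  Σpick-↭ {F = F} h (swap {xs} {ys} x y p) = begin
    F x (y ∷ xs) + (F y (x ∷ xs) + Σpick xs (λ z zs → F z (x ∷ y ∷ zs)))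
      ≈⟨ +-cong (h x (prep y p)) (+-cong (h y (prep x p)) (trans
           (Σpick-↭ (λ z q → h z (prep x (prep y q))) p)
           (Σpick-cong ys (λ z zs → h z (swap x y ↭-refl))))) ⟩
    F x (y ∷ ys) + (F y (x ∷ ys) + Σpick ys (λ z zs → F z (y ∷ x ∷ zs)))
      ≈⟨ solve 3 (λ a b c → a :+ (b :+ c) := b :+ (a :+ c)) refl _ _ _ ⟩
    F y (x ∷ ys) + (F x (y ∷ ys) + Σpick ys (λ z zs → F z (y ∷ x ∷ zs))) ∎
  Σpick-↭ h (Perm.trans p q) = trans (Σpick-↭ h p) (Σpick-↭ h q)

  Σarr-cong-↭ : ∀ k xs {f g} → length xs ≡ k → (∀ w → w ↭ xs → f w ≈ g w) → Σarr k xs f ≈ Σarr k xs g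
  Σarr-cong-↭ zero    []  eq h = h [] ↭-refl
  Σarr-cong-↭ (suc k) xs  eq h = Σpick-cong-↭ xs (λ y ys p →
    Σarr-cong-↭ k ys (ℕ.suc-injective (≡.trans (↭-length p) eq))
      (λ w q → h (y ∷ w) (↭-trans (prep y q) p)))

  Σarr-cong : ∀ k xs {f g} → (∀ w → f w ≈ g w) → Σarr k xs f ≈ Σarr k xs g
  Σarr-cong zero    xs h = h []
  Σarr-cong (suc k) xs h = Σpick-cong xs (λ y ys → Σarr-cong k ys (λ w → h (y ∷ w)))

  Σarr-cong-length : ∀ k xs {f g} → (∀ w → length w ≡ k → f w ≈ g w) → Σarr k xs f ≈ Σarr k xs g
  Σarr-cong-length zero    xs h = h [] ≡.refl
  Σarr-cong-length (suc k) xs h = Σpick-cong xs (λ y ys →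
    Σarr-cong-length k ys (λ w eq → h (y ∷ w) (≡.cong suc eq)))

  Σarr-zero : ∀ k xs {f} → (∀ w → f w ≈ 0#) → Σarr k xs f ≈ 0#
  Σarr-zero zero    xs h = h []
  Σarr-zero (suc k) xs h = Σpick-zero xs (λ y ys → Σarr-zero k ys (λ w → h (y ∷ w)))

  Σarr-+ : ∀ k xs f g → Σarr k xs (λ w → f w + g w) ≈ Σarr k xs f + Σarr k xs g
  Σarr-+ zero    xs f g = refl
  Σarr-+ (suc k) xs f g = trans (Σpick-cong xs (λ y ys → Σarr-+ k ys _ _)) (Σpick-+ xs _ _)

  Σarr-*ˡ : ∀ t k xs f → Σarr k xs (λ w → t * f w) ≈ t * Σarr k xs f
  Σarr-*ˡ t zero    xs f = refl
  Σarr-*ˡ t (suc k) xs f = trans (Σpick-cong xs (λ y ys → Σarr-*ˡ t k ys _)) (Σpick-*ˡ t xs _)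

  Σarr-↭ : ∀ k {xs ys} f → xs ↭ ys → Σarr k xs f ≈ Σarr k ys f
  Σarr-↭ zero    f p = refl
  Σarr-↭ (suc k) f p = Σpick-↭ (λ z q → Σarr-↭ k _ q) p

  Σarr₁ : ℕ → List E → (E → List E → Carrier) → Carrier
  Σarr₁ k xs f = Σpick xs (λ x ys → Σarr k ys (f x))

  Σarr₁-cong-length : ∀ k xs {f g} → (∀ x w → length w ≡ k → f x w ≈ g x w) → Σarr₁ k xs f ≈ Σarr₁ k xs g
  Σarr₁-cong-length k xs h = Σpick-cong xs (λ x ys → Σarr-cong-length k ys (h x))

  Σarr₁-cong-↭ : ∀ k xs {f g} → length xs ≡ suc k → (∀ x w → x ∷ w ↭ xs → f x w ≈ g x w) →
    Σarr₁ k xs f ≈ Σarr₁ k xs g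
  Σarr₁-cong-↭ k xs eq h = Σpick-cong-↭ xs (λ y ys p →
    Σarr-cong-↭ k ys (ℕ.suc-injective (≡.trans (↭-length p) eq)) (λ w q → h y w (↭-trans (prep y q) p)))

  Σarr₁-+ : ∀ k xs f g → Σarr₁ k xs (λ x w → f x w + g x w) ≈ Σarr₁ k xs f + Σarr₁ k xs g
  Σarr₁-+ k xs f g = trans
    (Σpick-cong xs {G = λ x ys → Σarr k ys (f x) + Σarr k ys (g x)} (λ x ys → Σarr-+ k ys (f x) (g x)))
    (Σpick-+ xs _ _)

  Σarr₁-*ˡ : ∀ t k xs f → Σarr₁ k xs (λ x w → t * f x w) ≈ t * Σarr₁ k xs f
  Σarr₁-*ˡ t k xs f = trans
    (Σpick-cong xs {G = λ x ys → t * Σarr k ys (f x)} (λ x ys → Σarr-*ˡ t k ys (f x)))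
    (Σpick-*ˡ t xs _)

  Σpick-++ : ∀ xs ys F →
    Σpick (xs ++ ys) F ≈ Σpick xs (λ x us → F x (us ++ ys)) + Σpick ys (λ y us → F y (xs ++ us))
  Σpick-++ []       ys F = sym (+-identityˡ _)
  Σpick-++ (x ∷ xs) ys F = trans (+-congˡ (Σpick-++ xs ys _)) (sym (+-assoc _ _ _))

  -- Successive picks commute, so the letter drawn first may be placed at any fixed position of the
  -- word.
  Σarr-insertAt : ∀ j k xs f →
    Σpick xs (λ x ys → Σarr k ys (λ w → f (insertAt j x w))) ≈ Σarr (suc k) xs f
  Σarr-insertAt zero    k       xs f = refl
  Σarr-insertAt (suc j) zero    xs f = refl
  Σarr-insertAt (suc j) (suc k) xs f = trans
    (Σpick-Σpick-comm xs (λ x y zs → Σarr k zs (λ w → f (y ∷ insertAt j x w))))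
    (Σpick-cong xs (λ y ys → Σarr-insertAt j k ys (λ w → f (y ∷ w))))

  -- Words are read as sequences of pairs p₁ q₁ p₂ q₂ …; Σswap exchanges x with one of the pₖ.
  Σswap : E → List E → (E → List E → Carrier) → Carrier
  Σswap x []          F = 0#
  Σswap x (p ∷ [])    F = 0#
  Σswap x (p ∷ q ∷ w) F = F p (x ∷ q ∷ w) + Σswap x w (λ y v → F y (p ∷ q ∷ v))

  Σswap-cong : ∀ x w {F G} → (∀ y v → F y v ≈ G y v) → Σswap x w F ≈ Σswap x w G
  Σswap-cong x []          h = refl
  Σswap-cong x (p ∷ [])    h = refl
  Σswap-cong x (p ∷ q ∷ w) h = +-cong (h _ _) (Σswap-cong x w (λ y v → h y _))

  Σswap-*ˡ : ∀ t x w F → Σswap x w (λ y v → t * F y v) ≈ t * Σswap x w F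
  Σswap-*ˡ t x []          F = sym (zeroʳ t)
  Σswap-*ˡ t x (p ∷ [])    F = sym (zeroʳ t)
  Σswap-*ˡ t x (p ∷ q ∷ w) F = trans (+-congˡ (Σswap-*ˡ t x w _)) (sym (distribˡ t _ _))

  -- Exchanging `x` with some pₖ is an involution on the pairs formed by a letter and a word, so
  -- every exchange may be read from either end. In effect the exchange operator is self-adjoint: it
  -- can be moved from one factor of a summand to the other.
  Σarr-Σswap-flip : ∀ k xs (G : E → List E → E → List E → Carrier) →
    Σpick xs (λ x ys → Σarr (double k) ys (λ w → Σswap x w (λ y v → G x w y v))) ≈
    Σpick xs (λ x ys → Σarr (double k) ys (λ w → Σswap x w (λ y v → G y v x w)))
  Σarr-Σswap-flip zero    xs G = refl
  Σarr-Σswap-flip (suc k) xs G = begin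
    Σpick xs (λ x ys → Σarr (double (suc k)) ys (λ w → Σswap x w (λ y v → G x w y v)))
      ≈⟨ split G ⟩
    first G + rest G
      -- An exchange with the first pair only interchanges the first two picks. For the other
      -- exchanges `p` and `q` are drawn before `x`, so that the induction hypothesis applies to the
      -- rest of the word.
      ≈⟨ +-cong
           (Σpick-Σpick-comm xs (λ x p ys → Σpick ys (λ q zs → Σarr (double k) zs (λ w →
             G x (p ∷ q ∷ w) p (x ∷ q ∷ w)))))
           (trans (Σpick-rotate xs _)
           (trans (Σpick-cong xs (λ p ys → Σpick-cong ys (λ q zs →
                    Σarr-Σswap-flip k zs (λ x w y v → G x (p ∷ q ∷ w) y (p ∷ q ∷ v)))))
           (sym (Σpick-rotate xs _)))) ⟩
    first G′ + rest G′
      ≈⟨ split G′ ⟨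
    Σpick xs (λ x ys → Σarr (double (suc k)) ys (λ w → Σswap x w (λ y v → G y v x w))) ∎
    where
    G′ : E → List E → E → List E → Carrier
    G′ x w y v = G y v x w
    first rest : (E → List E → E → List E → Carrier) → Carrier
    first H = Σpick xs (λ x ys → Σpick ys (λ p zs → Σpick zs (λ q us → Σarr (double k) us (λ w →
      H x (p ∷ q ∷ w) p (x ∷ q ∷ w)))))
    rest H = Σpick xs (λ x ys → Σpick ys (λ p zs → Σpick zs (λ q us → Σarr (double k) us (λ w →
      Σswap x w (λ y v → H x (p ∷ q ∷ w) y (p ∷ q ∷ v))))))
    split : ∀ H → Σpick xs (λ x ys → Σarr (double (suc k)) ys (λ w → Σswap x w (λ y v → H x w y v)))
      ≈ first H + rest H
    split H = trans (Σpick-cong xs (λ x ys → trans (Σpick-cong ys (λ p zs → trans (Σpick-cong zs (λ q us →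
      Σarr-+ (double k) us _ _)) (Σpick-+ zs _ _))) (Σpick-+ ys _ _))) (Σpick-+ xs _ _)

module _ {e : Level} {E : Set e} where
  -- An unpaired last letter goes to `odds`, so that `evens w ++ odds w` is a rearrangement of `w`
  -- for words of any length.
  evens odds flip : List E → List E
  evens []          = []
  evens (p ∷ [])    = []
  evens (p ∷ q ∷ w) = p ∷ evens w
  odds []           = []
  odds (p ∷ [])     = p ∷ []
  odds (p ∷ q ∷ w)  = q ∷ odds w
  flip []           = []
  flip (p ∷ [])     = p ∷ []
  flip (p ∷ q ∷ w)  = q ∷ p ∷ flip w

  flip-↭ : ∀ w → flip w ↭ w
  flip-↭ []          = ↭-refl
  flip-↭ (p ∷ [])    = ↭-refl
  flip-↭ (p ∷ q ∷ w) = swap q p (flip-↭ w)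

  evens-odds-↭ : ∀ w → evens w ++ odds w ↭ w
  evens-odds-↭ []          = ↭-refl
  evens-odds-↭ (p ∷ [])    = ↭-refl
  evens-odds-↭ (p ∷ q ∷ w) = prep p (↭-trans (shift q (evens w) (odds w)) (prep q (evens-odds-↭ w)))

  evens-flip : ∀ k w → length w ≡ double k → evens (flip w) ≡ odds w
  evens-flip zero    []          eq = ≡.refl
  evens-flip (suc k) (p ∷ q ∷ w) eq = ≡.cong (q ∷_) (evens-flip k w (ℕ.suc-injective (ℕ.suc-injective eq)))

  odds-flip : ∀ k w → length w ≡ double k → odds (flip w) ≡ evens w
  odds-flip zero    []          eq = ≡.refl
  odds-flip (suc k) (p ∷ q ∷ w) eq = ≡.cong (p ∷_) (odds-flip k w (ℕ.suc-injective (ℕ.suc-injective eq)))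

  length-evens : ∀ k w → length w ≡ double k → length (evens w) ≡ k
  length-evens zero    []          eq = ≡.refl
  length-evens (suc k) (p ∷ q ∷ w) eq = ≡.cong suc (length-evens k w (ℕ.suc-injective (ℕ.suc-injective eq)))

  length-odds : ∀ k w → length w ≡ double k → length (odds w) ≡ k
  length-odds zero    []          eq = ≡.refl
  length-odds (suc k) (p ∷ q ∷ w) eq = ≡.cong suc (length-odds k w (ℕ.suc-injective (ℕ.suc-injective eq)))

  Unique-↭ : ∀ {xs ys : List E} → xs ↭ ys → Unique ys → Unique xs
  Unique-↭ p = Unique-resp-↭ (≡.setoid E) (Perm.↭⇒↭ₛ (↭-sym p))

-- Plücker families: signs, exchange relations and partial fractions

module PlückerFamilies {c ℓ : Level} (R : CommutativeRing c ℓ) {e : Level} (E : Set e) where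
  open CommutativeRing R
  open RingDefs R using (prodR; fromℕR; negOnePow)
  open IntegerSolver R
  open Arrangements R E
  open SetoidReasoning setoid

  ∏ : ∀ {a} {A : Set a} → (A → Carrier) → List A → Carrier
  ∏ f xs = prodR (map f xs)

  module _ {a : Level} {A : Set a} where
    ∏-cong : ∀ xs {f g : A → Carrier} → (∀ x → f x ≈ g x) → ∏ f xs ≈ ∏ g xs
    ∏-cong []       h = refl
    ∏-cong (x ∷ xs) h = *-cong (h x) (∏-cong xs h)

    ∏-* : ∀ xs (f g : A → Carrier) → ∏ (λ x → f x * g x) xs ≈ ∏ f xs * ∏ g xs
    ∏-* []       f g = sym (*-identityˡ _)
    ∏-* (x ∷ xs) f g = trans (*-congˡ (∏-* xs f g))
      (solve 4 (λ a b c d → a :* b :* (c :* d) := a :* c :* (b :* d)) refl _ _ _ _)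

    ∏-++ : ∀ (f : A → Carrier) xs ys → ∏ f (xs ++ ys) ≈ ∏ f xs * ∏ f ys
    ∏-++ f []       ys = sym (*-identityˡ _)
    ∏-++ f (x ∷ xs) ys = trans (*-congˡ (∏-++ f xs ys)) (sym (*-assoc _ _ _))

    ∏-↭ : ∀ (f : A → Carrier) {xs ys} → xs ↭ ys → ∏ f xs ≈ ∏ f ys
    ∏-↭ f Perm.refl        = refl
    ∏-↭ f (prep x p)       = *-congˡ (∏-↭ f p)
    ∏-↭ f (swap x y p)     = trans (*-congˡ (*-congˡ (∏-↭ f p)))
      (solve 3 (λ a b c → a :* (b :* c) := b :* (a :* c)) refl _ _ _)
    ∏-↭ f (Perm.trans p q) = trans (∏-↭ f p) (∏-↭ f q)

    ∏-neg : ∀ xs (f : A → Carrier) → ∏ (λ x → - f x) xs ≈ negOnePow (length xs) * ∏ f xs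
    ∏-neg []       f = sym (*-identityˡ _)
    ∏-neg (x ∷ xs) f = trans (*-congˡ (∏-neg xs f))
      (solve 3 (λ a b c → :- a :* (b :* c) := :- b :* (a :* c)) refl _ _ _)

  negOnePow-sq : ∀ k → negOnePow k * negOnePow k ≈ 1#
  negOnePow-sq zero    = *-identityˡ _
  negOnePow-sq (suc k) = trans (solve 1 (λ x → :- x :* :- x := x :* x) refl _) (negOnePow-sq k)

  cross : (E → E → Carrier) → List E → List E → Carrier
  cross w P Q = ∏ (λ p → ∏ (w p) Q) P

  cross-congˡ : ∀ w {P P′} Q → P ↭ P′ → cross w P Q ≈ cross w P′ Q
  cross-congˡ w Q p = ∏-↭ _ p

  cross-congʳ : ∀ w P {Q Q′} → Q ↭ Q′ → cross w P Q ≈ cross w P Q′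
  cross-congʳ w P q = ∏-cong P (λ p → ∏-↭ (w p) q)

  cross-∷ʳ : ∀ w P q Q → cross w P (q ∷ Q) ≈ ∏ (λ p → w p q) P * cross w P Q
  cross-∷ʳ w P q Q = ∏-* P (λ p → w p q) (λ p → ∏ (w p) Q)

  pairProd : (E → E → Carrier) → List E → Carrier
  pairProd a (p ∷ q ∷ w) = a p q * pairProd a w
  pairProd a _           = 1#

  -- The zero diagonal is a field of its own because 2 may be a zero divisor in `R`, and then
  -- `x i i ≈ - x i i` does not imply it.
  record Antisymmetric (x : E → E → Carrier) : Set (e Level.⊔ c Level.⊔ ℓ) where
    field
      antisym : ∀ i j → x i j ≈ - x j i
      diag    : ∀ i → x i i ≈ 0#

  record Plücker (x : E → E → Carrier) : Set (e Level.⊔ c Level.⊔ ℓ) where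
    field
      antisymmetric : Antisymmetric x
      three-term    : ∀ i j k l → x i j * x k l + - (x i k * x j l) + x j k * x i l ≈ 0#
    open Antisymmetric antisymmetric public

    -- Here `i` trades places with each index of the other factor: with `k` in the first term and
    -- with `l` in the second, whose minus sign comes from writing `x j l` for `x l j`.
    exchange : ∀ i j k l → x i j * x k l ≈ x k j * x i l - x j l * x k i
    exchange i j k l = begin
      x i j * x k l
        ≈⟨ solve 6 (λ ij kl ik jl jk il →
             ij :* kl := (ij :* kl :+ :- (ik :* jl) :+ jk :* il) :+ (ik :* jl :- jk :* il)) refl _ _ _ _ _ _ ⟩
      (x i j * x k l + - (x i k * x j l) + x j k * x i l) + (x i k * x j l - x j k * x i l)
        ≈⟨ +-cong (three-term i j k l) (+-cong (*-congʳ (antisym i k)) (-‿cong (*-congʳ (antisym j k)))) ⟩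
      0# + (- x k i * x j l - (- x k j) * x i l)
        ≈⟨ solve 4 (λ ki jl kj il → con (ℤ.+ 0) :+ (:- ki :* jl :- (:- kj) :* il) := kj :* il :- jl :* ki) refl _ _ _ _ ⟩
      x k j * x i l - x j l * x k i ∎

  module _ {w} (anti : Antisymmetric w) where
    open Antisymmetric anti

    ∏-transpose : ∀ x k ys → length ys ≡ k → ∏ (w x) ys ≈ negOnePow k * ∏ (λ y → w y x) ys
    ∏-transpose x k ys ≡.refl = trans (∏-cong ys (λ y → antisym x y)) (∏-neg ys (λ y → w y x))

    -- Each of the k² factors changes sign, and k² has the parity of k.
    cross-transpose : ∀ k P Q → length P ≡ k → length Q ≡ k → cross w Q P ≈ negOnePow k * cross w P Q
    cross-transpose zero    []      []      _  _  = sym (*-identityˡ _)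
    cross-transpose (suc k) (p ∷ P) (q ∷ Q) eP eQ = begin
      (w q p * ∏ (w q) P) * cross w Q (p ∷ P)
        ≈⟨ *-cong (*-cong (antisym q p) (∏-transpose q k P (ℕ.suc-injective eP))) (trans (cross-∷ʳ w Q p P)
             (*-cong (trans (∏-cong Q (λ q′ → antisym q′ p)) (trans (∏-neg Q (w p)) (*-congʳ (reflexive (≡.cong negOnePow (ℕ.suc-injective eQ))))))
                     (cross-transpose k P Q (ℕ.suc-injective eP) (ℕ.suc-injective eQ)))) ⟩
      (- w p q * (ε * ∏ (λ p′ → w p′ q) P)) * (ε * ∏ (w p) Q * (ε * cross w P Q))
        ≈⟨ solve 5 (λ ε a b c d → (:- a :* (ε :* b)) :* (ε :* c :* (ε :* d)) := ε :* ε :* (:- ε :* ((a :* c) :* (b :* d)))) refl _ _ _ _ _ ⟩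
      ε * ε * (- ε * ((w p q * ∏ (w p) Q) * (∏ (λ p′ → w p′ q) P * cross w P Q)))
        ≈⟨ trans (*-congʳ (negOnePow-sq k)) (*-identityˡ _) ⟩
      - ε * ((w p q * ∏ (w p) Q) * (∏ (λ p′ → w p′ q) P * cross w P Q))
        ≈⟨ *-congˡ (*-congˡ (cross-∷ʳ w P q Q)) ⟨
      - ε * ((w p q * ∏ (w p) Q) * cross w P (q ∷ Q)) ∎
      where ε = negOnePow k

    cross-flip : ∀ k v → length v ≡ double k →
      cross w (evens (flip v)) (odds (flip v)) ≈ negOnePow k * cross w (evens v) (odds v)
    cross-flip k v eq = trans
      (reflexive (≡.cong₂ (cross w) (evens-flip k v eq) (odds-flip k v eq)))
      (cross-transpose k (evens v) (odds v) (length-evens k v eq) (length-odds k v eq))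

    pairProd-flip : ∀ k v → length v ≡ double k → pairProd w (flip v) ≈ negOnePow k * pairProd w v
    pairProd-flip zero    []          eq = sym (*-identityˡ _)
    pairProd-flip (suc k) (p ∷ q ∷ v) eq = trans
      (*-cong (antisym q p) (pairProd-flip k v (ℕ.suc-injective (ℕ.suc-injective eq))))
      (solve 3 (λ a ε b → :- a :* (ε :* b) := :- ε :* (a :* b)) refl _ _ _)

  -- Summed over the exchanges of i with the first entries of the pairs, a i n · ∏ a pₖ qₖ is
  -- recovered up to a factor after adding the same sum for the flipped pairs.
  module _ {a} (pl : Plücker a) where
    open Plücker pl

    Σswap-pairProd : ∀ n k i v → length v ≡ double k →
      Σswap i v (λ x u → a x n * pairProd a u) + negOnePow k * Σswap i (flip v) (λ x u → a x n * pairProd a u)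
        ≈ fromℕR k * (a i n * pairProd a v)
    Σswap-pairProd n zero    i []          eq =
      trans (+-identityˡ _) (trans (zeroʳ 1#) (sym (zeroˡ _)))
    Σswap-pairProd n (suc k) i (r ∷ s ∷ v) eq = begin
      (a r n * (a i s * A) + Σswap i v (λ x u → a x n * (a r s * pairProd a u)))
        + - ε * (a s n * (a i r * pairProd a (flip v)) + Σswap i (flip v) (λ x u → a x n * (a s r * pairProd a u)))
        ≈⟨ +-cong (+-congˡ (pull r s v)) (*-congˡ (+-cong (*-congˡ (*-congˡ (pairProd-flip antisymmetric k v len)))
             (trans (pull s r (flip v)) (*-congʳ (antisym s r))))) ⟩
      (a r n * (a i s * A) + a r s * D v) + - ε * (a s n * (a i r * (ε * A)) + - a r s * D (flip v))
        ≈⟨ solve 9 (λ rn is A rs D ε sn ir D′ →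
             (rn :* (is :* A) :+ rs :* D) :+ :- ε :* (sn :* (ir :* (ε :* A)) :+ :- rs :* D′)
             := rs :* (D :+ ε :* D′) :+ (is :* rn :- (ε :* ε) :* (sn :* ir)) :* A) refl _ _ _ _ _ _ _ _ _ ⟩
      a r s * (D v + ε * D (flip v)) + (a i s * a r n - (ε * ε) * (a s n * a i r)) * A
        -- The two exchanges with the pair `r`, `s` combine by the Plücker relation into
        -- `a r s * a i n`, one further copy of the whole product; the other pairs supply `k` copies
        -- by induction.
        ≈⟨ +-cong (*-congˡ (Σswap-pairProd n k i v len))
             (*-congʳ (trans (+-congˡ (-‿cong (trans (*-congʳ (negOnePow-sq k)) (*-identityˡ _)))) (sym (exchange r s i n)))) ⟩
      a r s * (fromℕR k * (a i n * A)) + (a r s * a i n) * A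
        ≈⟨ solve 4 (λ rs k in′ A → rs :* (k :* (in′ :* A)) :+ (rs :* in′) :* A := in′ :* (rs :* A) :+ k :* (in′ :* (rs :* A))) refl _ _ _ _ ⟩
      a i n * (a r s * A) + fromℕR k * (a i n * (a r s * A))
        ≈⟨ +-congʳ (*-identityˡ _) ⟨
      1# * (a i n * (a r s * A)) + fromℕR k * (a i n * (a r s * A))
        ≈⟨ distribʳ _ _ _ ⟨
      (1# + fromℕR k) * (a i n * (a r s * A)) ∎
      where
      ε = negOnePow k
      A = pairProd a v
      len = ℕ.suc-injective (ℕ.suc-injective eq)
      D : List E → Carrier
      D u = Σswap i u (λ x u′ → a x n * pairProd a u′)
      pull : ∀ p q u → Σswap i u (λ x u′ → a x n * (a p q * pairProd a u′)) ≈ a p q * D u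
      pull p q u = trans
        (Σswap-cong i u (λ x u′ → solve 3 (λ a b c → a :* (b :* c) := b :* (a :* c)) refl _ _ _))
        (Σswap-*ˡ (a p q) i u _)

  -- An exchange leaves the second entries in place and only changes which element of `p ∷ evens v`
  -- stands outside the word. A term that sees the first entries only up to order therefore sums to
  -- one pick from that list, the unexchanged term being the pick of `p`.
  Σswap-evens : ∀ p v {V F : E → List E → Carrier} → (∀ x {us vs} → us ↭ vs → F x us ≈ F x vs) →
    (∀ x u → odds u ≡ odds v → x ∷ evens u ↭ p ∷ evens v → V x u ≈ F x (evens u)) →
    V p v + Σswap p v V ≈ Σpick (p ∷ evens v) F
  Σswap-evens p v {V} {F} resp h = +-cong (h p v ≡.refl ↭-refl) (go v V F resp (λ x u e q → h x u e q))
    where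
    go : ∀ v V F → (∀ x {us vs} → us ↭ vs → F x us ≈ F x vs) →
      (∀ x u → odds u ≡ odds v → x ∷ evens u ↭ p ∷ evens v → V x u ≈ F x (evens u)) →
      Σswap p v V ≈ Σpick (evens v) (λ x us → F x (p ∷ us))
    go []          V F resp h = refl
    go (r ∷ [])    V F resp h = refl
    go (r ∷ s ∷ v) V F resp h = +-cong (h r (p ∷ s ∷ v) ≡.refl (swap r p ↭-refl))
      (trans (go v (λ x u → V x (r ∷ s ∷ u)) (λ x us → F x (r ∷ us)) (λ x q → resp x (prep r q))
               (λ x u e q → h x (r ∷ s ∷ u) (≡.cong (s ∷_) e) (↭-trans (swap x r ↭-refl) (↭-trans (prep r q) (swap r p ↭-refl)))))
             (Σpick-cong (evens v) (λ x us → resp x (swap r p ↭-refl))))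

  module _ {z w : E → E → Carrier} (pl : Plücker z) (inv : ∀ i j → i ≢ j → z i j * w i j ≈ 1#)
           (antiʷ : Antisymmetric w) where
    open Plücker pl

    -- The factor `z i t` cancels the pole `w i t`, and for `i = t` it vanishes by the zero
    -- diagonal; so `t` leaves the set of nodes.
    drop-pole : ∀ t T (g : E → Carrier) → Unique (t ∷ T) →
      Σpick (t ∷ T) (λ i us → ∏ (w i) us * (z i t * g i)) ≈ Σpick T (λ i us → ∏ (w i) us * g i)
    drop-pole t T g (t∉T ∷ _) = trans
      (+-cong (trans (*-congˡ (trans (*-congʳ (diag t)) (zeroˡ _))) (zeroʳ _))
        (Σpick-cong-↭ T (λ i us p → trans
          (solve 4 (λ w p z g → (w :* p) :* (z :* g) := (z :* w) :* (p :* g)) refl _ _ _ _)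
          (trans (*-congʳ (inv i t (≡.≢-sym (All.head (All-resp-↭ (↭-sym p) t∉T))))) (*-identityˡ _)))))
      (+-identityˡ _)

    -- The exchange relation makes z i j a combination of z i t and z i u; each of them cancels a pole.
    Σpick-partial-fractions : ∀ T J → Unique T → length T ≡ suc (suc (length J)) →
      Σpick T (λ i us → ∏ (w i) us * ∏ (z i) J) ≈ 0#
    -- With two nodes and an empty numerator, `w t u` and `w u t` cancel by antisymmetry.
    Σpick-partial-fractions (t ∷ u ∷ []) [] _ eq =
      trans (+-congʳ (*-congʳ (*-congʳ (Antisymmetric.antisym antiʷ t u))))
        (solve 2 (λ a o → ((:- a) :* o) :* o :+ (a :* o :* o :+ con (ℤ.+ 0)) := con (ℤ.+ 0)) refl _ _)
    Σpick-partial-fractions (t ∷ u ∷ T) (j ∷ J) uniq@((t≢u ∷ t∉T) ∷ (u∉T ∷ uT)) eq = begin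
      Σpick S (λ i us → ∏ (w i) us * (z i j * ∏ (z i) J))
        ≈⟨ Σpick-cong S {G = λ i us → α * F t i us + β * F u i us} (λ i us → trans (*-congˡ (*-congʳ (expand i)))
             (solve 6 (λ p α x β y q → p :* ((α :* x :+ β :* y) :* q) := α :* (p :* (x :* q)) :+ β :* (p :* (y :* q)))
               refl (∏ (w i) us) α (z i t) β (z i u) (∏ (z i) J))) ⟩
      Σpick S (λ i us → α * F t i us + β * F u i us)
        ≈⟨ trans (Σpick-+ S (λ i us → α * F t i us) (λ i us → β * F u i us))
             (+-cong (Σpick-*ˡ α S (F t)) (Σpick-*ˡ β S (F u))) ⟩
      α * Σpick S (F t) + β * Σpick S (F u)
        ≈⟨ +-cong
             (*-congˡ (trans (drop-pole t (u ∷ T) (λ i → ∏ (z i) J) uniq)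
               (Σpick-partial-fractions (u ∷ T) J (u∉T ∷ uT) (ℕ.suc-injective eq))))
             (*-congˡ (trans (Σpick-↭ {S} {u ∷ t ∷ T} {F u} (λ i p → *-congʳ (∏-↭ (w i) p)) (swap t u ↭-refl))
               (trans (drop-pole u (t ∷ T) (λ i → ∏ (z i) J) ((≡.≢-sym t≢u ∷ u∉T) ∷ (t∉T ∷ uT)))
                      (Σpick-partial-fractions (t ∷ T) J (t∉T ∷ uT) (ℕ.suc-injective eq))))) ⟩
      α * 0# + β * 0#
        ≈⟨ solve 2 (λ a b → a :* con (ℤ.+ 0) :+ b :* con (ℤ.+ 0) := con (ℤ.+ 0)) refl _ _ ⟩
      0# ∎
      where
      S = t ∷ u ∷ T
      α = w t u * z j u
      β = - (w t u * z j t)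
      F : E → E → List E → Carrier
      F v i us = ∏ (w i) us * (z i v * ∏ (z i) J)
      expand : ∀ i → z i j ≈ α * z i t + β * z i u
      expand i = begin
        z i j                                          ≈⟨ *-identityʳ _ ⟨
        z i j * 1#                                     ≈⟨ *-congˡ (inv t u t≢u) ⟨
        z i j * (z t u * w t u)                        ≈⟨ *-assoc _ _ _ ⟨
        (z i j * z t u) * w t u                        ≈⟨ *-congʳ (exchange i j t u) ⟩
        (z t j * z i u - z j u * z t i) * w t u        ≈⟨ *-congʳ (+-cong (*-congʳ (antisym t j)) (-‿cong (*-congˡ (antisym t i)))) ⟩
        (- z j t * z i u - z j u * - z i t) * w t u    ≈⟨ solve 5 (λ jt iu ju it w → (:- jt :* iu :- ju :* :- it) :* w :=
                                                            (w :* ju) :* it :+ :- (w :* jt) :* iu) refl _ _ _ _ _ ⟩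
        α * z i t + β * z i u                          ∎

-- Sums over words of pairs, and the exchange inside them

module _ {e : Level} {E : Set e} where
  -- These transpositions of neighbouring pairs generate all reorderings of the pairs, so invariance
  -- under one such step is enough to bring any chosen pair to the front.
  data PairSwap : List E → List E → Set e where
    here  : ∀ x y r s w → PairSwap (x ∷ y ∷ r ∷ s ∷ w) (r ∷ s ∷ x ∷ y ∷ w)
    there : ∀ x y {v w} → PairSwap v w → PairSwap (x ∷ y ∷ v) (x ∷ y ∷ w)

  PairSwap-evens : ∀ {v w : List E} → PairSwap v w → evens v ↭ evens w
  PairSwap-evens (here x y r s w) = swap x r ↭-refl
  PairSwap-evens (there x y p)    = prep x (PairSwap-evens p)

  PairSwap-odds : ∀ {v w : List E} → PairSwap v w → odds v ↭ odds w
  PairSwap-odds (here x y r s w) = swap y s ↭-refl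
  PairSwap-odds (there x y p)    = prep y (PairSwap-odds p)

module PairSums {c ℓ : Level} (R : CommutativeRing c ℓ) {e : Level} (E : Set e) where
  open CommutativeRing R
  open RingDefs R using (fromℕR; negOnePow)
  open IntegerSolver R
  open Arrangements R E
  open PlückerFamilies R E
  open SetoidReasoning setoid

  Σarr-flip : ∀ k xs f → Σarr (double k) xs (λ v → f (flip v)) ≈ Σarr (double k) xs f
  Σarr-flip zero    xs f = refl
  Σarr-flip (suc k) xs f = trans
    (Σpick-cong xs (λ p ys → Σpick-cong ys (λ q zs → Σarr-flip k zs (λ v → f (q ∷ p ∷ v)))))
    (Σpick-Σpick-comm xs (λ p q zs → Σarr (double k) zs (λ v → f (q ∷ p ∷ v))))

  Σarr₁-flip : ∀ k xs f → Σarr₁ (double k) xs (λ x v → f x (flip v)) ≈ Σarr₁ (double k) xs f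
  Σarr₁-flip k xs f = Σpick-cong xs (λ x ys → Σarr-flip k ys (f x))

  -- Invariance under pair swaps lets the pair containing `n` be moved to the front from any of its
  -- `suc k` places; the two sums are the two positions of `n` within this pair.
  Σarr-∷ : ∀ k n N f → (∀ {v w} → PairSwap v w → f v ≈ f w) → length N ≡ suc (double k) →
    Σarr (double (suc k)) (n ∷ N) f ≈
      fromℕR (suc k) * (Σarr₁ (double k) N (λ p v → f (n ∷ p ∷ v)) + Σarr₁ (double k) N (λ p v → f (p ∷ n ∷ v)))
  Σarr-∷ zero    n (x ∷ []) f resp eq = trans
    (solve 2 (λ a b → (a :+ con (ℤ.+ 0)) :+ ((b :+ con (ℤ.+ 0)) :+ con (ℤ.+ 0)) := (a :+ con (ℤ.+ 0)) :+ (b :+ con (ℤ.+ 0))) refl _ _)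
    (sym (trans (*-congʳ (+-identityʳ 1#)) (*-identityˡ _)))
  Σarr-∷ (suc k) n N f resp eq = begin
    S₀ + Σpick N (λ x ys → U x ys + Σpick ys (λ y zs → V x y zs))
      ≈⟨ +-congˡ (Σpick-+ N U (λ x ys → Σpick ys (V x))) ⟩
    S₀ + (S₁ + Σpick N (λ x ys → Σpick ys (V x)))
      ≈⟨ +-congˡ (+-congˡ (Σpick-cong-↭ N {G = λ x ys → Σpick ys (λ y zs → κ * (D₀ x y zs + D₁ x y zs))}
           (λ x ys p → Σpick-cong-↭ ys (λ y zs q → Σarr-∷ k n zs (λ v → f (x ∷ y ∷ v)) (λ r → resp (there x y r))
             (ℕ.suc-injective (ℕ.suc-injective (≡.trans (≡.cong suc (↭-length q)) (≡.trans (↭-length p) eq)))))))) ⟩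
    S₀ + (S₁ + Σpick N (λ x ys → Σpick ys (λ y zs → κ * (D₀ x y zs + D₁ x y zs))))
      ≈⟨ +-congˡ (+-congˡ (trans
           (Σpick-cong N {G = λ x ys → κ * (Σpick ys (D₀ x) + Σpick ys (D₁ x))} (λ x ys → trans
             (Σpick-*ˡ κ ys (λ y zs → D₀ x y zs + D₁ x y zs)) (*-congˡ (Σpick-+ ys (D₀ x) (D₁ x)))))
           (trans (Σpick-*ˡ κ N (λ x ys → Σpick ys (D₀ x) + Σpick ys (D₁ x)))
             (*-congˡ (Σpick-+ N (λ x ys → Σpick ys (D₀ x)) (λ x ys → Σpick ys (D₁ x))))))) ⟩
    S₀ + (S₁ + κ * (Σpick N (λ x ys → Σpick ys (D₀ x)) + Σpick N (λ x ys → Σpick ys (D₁ x))))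
      -- The induction hypothesis puts `n` into the second pair. The swap `here` carries that pair
      -- past `x`, `y`, and the rotation makes the partner of `n` the first element picked.
      ≈⟨ +-congˡ (+-congˡ (*-congˡ (+-cong
           (rotate (λ x y z v → f (x ∷ y ∷ n ∷ z ∷ v)) (λ p v → f (n ∷ p ∷ v)) (λ x y z v → resp (here x y n z v)))
           (rotate (λ x y z v → f (x ∷ y ∷ z ∷ n ∷ v)) (λ p v → f (p ∷ n ∷ v)) (λ x y z v → resp (here x y z n v)))))) ⟩
    S₀ + (S₁ + κ * (S₀ + S₁))
      ≈⟨ trans (sym (+-assoc _ _ _)) (+-congʳ (sym (*-identityˡ _))) ⟩
    1# * (S₀ + S₁) + κ * (S₀ + S₁)
      ≈⟨ distribʳ _ _ _ ⟨
    (1# + κ) * (S₀ + S₁) ∎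
    where
    κ = fromℕR (suc k)
    S₀ = Σarr₁ (double (suc k)) N (λ p v → f (n ∷ p ∷ v))
    S₁ = Σarr₁ (double (suc k)) N (λ p v → f (p ∷ n ∷ v))
    U : E → List E → Carrier
    U x ys = Σarr (double (suc k)) ys (λ v → f (x ∷ n ∷ v))
    V D₀ D₁ : E → E → List E → Carrier
    V x y zs = Σarr (double (suc k)) (n ∷ zs) (λ v → f (x ∷ y ∷ v))
    D₀ x y zs = Σarr₁ (double k) zs (λ p v → f (x ∷ y ∷ n ∷ p ∷ v))
    D₁ x y zs = Σarr₁ (double k) zs (λ p v → f (x ∷ y ∷ p ∷ n ∷ v))
    rotate : ∀ (H : E → E → E → List E → Carrier) (K : E → List E → Carrier) →
      (∀ x y z v → H x y z v ≈ K z (x ∷ y ∷ v)) →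
      Σpick N (λ x ys → Σpick ys (λ y zs → Σarr₁ (double k) zs (H x y))) ≈ Σarr₁ (double (suc k)) N K
    rotate H K h = trans
      (Σpick-cong N (λ x ys → Σpick-cong ys (λ y zs → Σpick-cong zs (λ z us → Σarr-cong (double k) us (λ v → h x y z v)))))
      (sym (Σpick-rotate N (λ x y z us → Σarr (double k) us (λ v → K x (y ∷ z ∷ v)))))

  module _ {a} (pl : Plücker a) (n : E) where
    open Plücker pl

    private
      A : List E → Carrier
      A = pairProd a
      D B : E → List E → Carrier
      D x v = Σswap x v (λ y u → a y n * A u)
      B x v = a x n * A v + D x v

    -- Of the `k + 2` copies, `k` come from the exchanges with the pairs of `v` and of `flip v`, and
    -- two from the unexchanged terms of these words.
    B-flip : ∀ k x v → length v ≡ double k →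
      fromℕR (suc (suc k)) * (a x n * A v) ≈ B x v + negOnePow k * B x (flip v)
    B-flip k x v eq = begin
      (1# + (1# + fromℕR k)) * (a x n * A v)
        ≈⟨ trans (distribʳ _ _ _) (+-cong (*-identityˡ _) (trans (distribʳ _ _ _) (+-congʳ (*-identityˡ _)))) ⟩
      a x n * A v + (a x n * A v + fromℕR k * (a x n * A v))
        ≈⟨ +-congˡ (+-cong (*-congˡ ε²A) (sym (Σswap-pairProd pl n k x v eq))) ⟩
      a x n * A v + (a x n * (ε * A (flip v)) + (D x v + ε * D x (flip v)))
        ≈⟨ solve 6 (λ xn A ε A′ d d′ → xn :* A :+ (xn :* (ε :* A′) :+ (d :+ ε :* d′)) :=
             (xn :* A :+ d) :+ ε :* (xn :* A′ :+ d′)) refl _ _ _ _ _ _ ⟩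
      B x v + ε * B x (flip v) ∎
      where
      ε = negOnePow k
      ε²A : A v ≈ ε * A (flip v)
      ε²A = sym (trans (*-congˡ (pairProd-flip antisymmetric k v eq)) (trans (sym (*-assoc _ _ _))
              (trans (*-congʳ (negOnePow-sq k)) (*-identityˡ _))))

    -- By `B-flip` each product splits into a part for `v` and one for `flip v`. As `V` has the same
    -- sign under `flip`, both parts have the same sum, hence the factor two. Self-adjointness of
    -- the exchange then moves it from the product of the `a`'s onto `V`.
    Σarr₁-exchange : ∀ k xs (V : E → List E → Carrier) →
      (∀ x v → length v ≡ double k → V x (flip v) ≈ negOnePow k * V x v) →
      fromℕR (suc (suc k)) * Σarr₁ (double k) xs (λ x v → (a x n * A v) * V x v) ≈
        (1# + 1#) * Σarr₁ (double k) xs (λ x v → (a x n * A v) * (V x v + Σswap x v V))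
    Σarr₁-exchange k xs V V-flip = begin
      fromℕR (suc (suc k)) * Σarr₁ (double k) xs (λ x v → (a x n * A v) * V x v)
        ≈⟨ Σarr₁-*ˡ _ (double k) xs _ ⟨
      Σarr₁ (double k) xs (λ x v → fromℕR (suc (suc k)) * ((a x n * A v) * V x v))
        ≈⟨ Σarr₁-cong-length (double k) xs (λ x v eq → trans (sym (*-assoc _ _ _)) (trans (*-congʳ (B-flip k x v eq))
             (trans (solve 4 (λ b ε b′ v → (b :+ ε :* b′) :* v := b :* v :+ b′ :* (ε :* v)) refl _ _ _ _)
               (+-congˡ (*-congˡ (sym (V-flip x v eq))))))) ⟩
      Σarr₁ (double k) xs (λ x v → B x v * V x v + B x (flip v) * V x (flip v))
        ≈⟨ trans (Σarr₁-+ (double k) xs _ _) (+-congˡ (Σarr₁-flip k xs (λ x v → B x v * V x v))) ⟩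
      Σarr₁ (double k) xs (λ x v → B x v * V x v) + Σarr₁ (double k) xs (λ x v → B x v * V x v)
        ≈⟨ trans (distribʳ _ _ _) (+-cong (*-identityˡ _) (*-identityˡ _)) ⟨
      (1# + 1#) * S
        ≈⟨ *-congˡ (begin
          S
            ≈⟨ Σarr₁-cong-length (double k) xs (λ x v _ → trans (distribʳ _ _ _)
                 (+-congˡ (trans (*-comm _ _) (sym (Σswap-*ˡ (V x v) x v (λ y u → a y n * A u)))))) ⟩
          Σarr₁ (double k) xs (λ x v → (a x n * A v) * V x v + Σswap x v (λ y u → V x v * (a y n * A u)))
            ≈⟨ Σarr₁-+ (double k) xs _ _ ⟩
          Σarr₁ (double k) xs (λ x v → (a x n * A v) * V x v)
            + Σarr₁ (double k) xs (λ x v → Σswap x v (λ y u → V x v * (a y n * A u)))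
            ≈⟨ +-congˡ (Σarr-Σswap-flip k xs (λ x v y u → V x v * (a y n * A u))) ⟩
          Σarr₁ (double k) xs (λ x v → (a x n * A v) * V x v)
            + Σarr₁ (double k) xs (λ x v → Σswap x v (λ y u → V y u * (a x n * A v)))
            ≈⟨ Σarr₁-+ (double k) xs _ _ ⟨
          Σarr₁ (double k) xs (λ x v → (a x n * A v) * V x v + Σswap x v (λ y u → V y u * (a x n * A v)))
            ≈⟨ Σarr₁-cong-length (double k) xs (λ x v _ → trans
                 (+-congˡ (trans (Σswap-cong x v (λ y u → *-comm _ _)) (Σswap-*ˡ (a x n * A v) x v V)))
                 (sym (distribˡ _ _ _))) ⟩
          Σarr₁ (double k) xs (λ x v → (a x n * A v) * (V x v + Σswap x v V)) ∎) ⟩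
      (1# + 1#) * Σarr₁ (double k) xs (λ x v → (a x n * A v) * (V x v + Σswap x v V)) ∎
      where
      S = Σarr₁ (double k) xs (λ x v → B x v * V x v)

    -- The poles between first and second entries, together with those between `x` and the second
    -- entries, form `cross w (x ∷ evens v) (odds v)`, which no exchange alters. Only the poles
    -- between the outside letter and the remaining first entries, and the weight `u`, are left
    -- inside the sum over exchanges.
    Σarr₁-exchange-cross : ∀ {w} → Antisymmetric w → ∀ k xs (u : E → List E → Carrier) →
      (∀ x {us vs} → us ↭ vs → u x us ≈ u x vs) →
      fromℕR (suc (suc k)) * Σarr₁ (double k) xs (λ x v →
          (a x n * A v) * ((cross w (evens v) (odds v) * ∏ (w x) v) * u x v)) ≈
        (1# + 1#) * Σarr₁ (double k) xs (λ x v → (a x n * A v) *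
          (cross w (x ∷ evens v) (odds v) * Σpick (x ∷ evens v) (λ y us → ∏ (w y) us * u y (us ++ odds v))))
    Σarr₁-exchange-cross {w} antiʷ k xs u resp = trans
      (Σarr₁-exchange k xs V (λ x v eq → trans
        (*-cong (*-cong (cross-flip antiʷ k v eq) (∏-↭ (w x) (flip-↭ v))) (resp x (flip-↭ v)))
        (solve 4 (λ ε c p u → ((ε :* c) :* p) :* u := ε :* ((c :* p) :* u)) refl _ _ _ _)))
      (*-congˡ (Σarr₁-cong-length (double k) xs (λ x v _ → *-congˡ (trans
        (Σswap-evens x v {V} {λ y us → X x v * (∏ (w y) us * u y (us ++ odds v))}
          (λ y p → *-congˡ (*-cong (∏-↭ (w y) p) (resp y (++⁺ʳ (odds v) p))))
          (λ y v′ eq p → regroup x v y v′ eq p))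
        (Σpick-*ˡ (X x v) (x ∷ evens v) (λ y us → ∏ (w y) us * u y (us ++ odds v)))))))
      where
      V X : E → List E → Carrier
      V x v = (cross w (evens v) (odds v) * ∏ (w x) v) * u x v
      X x v = cross w (x ∷ evens v) (odds v)
      regroup : ∀ x v y v′ → odds v′ ≡ odds v → y ∷ evens v′ ↭ x ∷ evens v →
        V y v′ ≈ X x v * (∏ (w y) (evens v′) * u y (evens v′ ++ odds v))
      regroup x v y v′ eq p = begin
        (cross w (evens v′) (odds v′) * ∏ (w y) v′) * u y v′
          ≈⟨ *-cong (*-congˡ (trans (∏-↭ (w y) (↭-sym (evens-odds-↭ v′))) (∏-++ (w y) (evens v′) (odds v′))))
               (resp y (↭-sym (evens-odds-↭ v′))) ⟩
        (cross w (evens v′) (odds v′) * (∏ (w y) (evens v′) * ∏ (w y) (odds v′))) * u y (evens v′ ++ odds v′)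
          ≈⟨ solve 4 (λ c e o u → (c :* (e :* o)) :* u := (o :* c) :* (e :* u)) refl _ _ _ _ ⟩
        cross w (y ∷ evens v′) (odds v′) * (∏ (w y) (evens v′) * u y (evens v′ ++ odds v′))
          ≡⟨ ≡.cong (λ o → cross w (y ∷ evens v′) o * (∏ (w y) (evens v′) * u y (evens v′ ++ o))) eq ⟩
        cross w (y ∷ evens v′) (odds v) * (∏ (w y) (evens v′) * u y (evens v′ ++ odds v))
          ≈⟨ *-congʳ (cross-congˡ w (odds v) p) ⟩
        X x v * (∏ (w y) (evens v′) * u y (evens v′ ++ odds v)) ∎

-- Interpolation and the inductive factorisation

AllPairs-++⁻ˡ : ∀ {a r} {A : Set a} {S : A → A → Set r} xs {ys} → AllPairs S (xs ++ ys) → AllPairs S xs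
AllPairs-++⁻ˡ []       _        = []
AllPairs-++⁻ˡ (x ∷ xs) (p ∷ ps) = All.++⁻ˡ xs p ∷ AllPairs-++⁻ˡ xs ps

module Factorisation {c ℓ : Level} (R : CommutativeRing c ℓ) {e : Level} (E : Set e) where
  open CommutativeRing R
  open RingDefs R using (fromℕR; negOnePow)
  open IntegerSolver R
  open Arrangements R E
  open PlückerFamilies R E
  open PairSums R E
  open SetoidReasoning setoid

  -- This is k! (k+1)!, in the form in which the induction produces it: one step contributes `k + 1`
  -- and `k + 2`.
  coefficient : ℕ → Carrier
  coefficient zero    = 1#
  coefficient (suc k) = fromℕR (suc k) * fromℕR (suc (suc k)) * coefficient k

  module Poles {z w : E → E → Carrier} (plᶻ : Plücker z) (antiʷ : Antisymmetric w)
               (inv : ∀ i j → i ≢ j → z i j * w i j ≈ 1#) where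

    term : (E → E → Carrier) → List E → Carrier
    term a v = pairProd a v * cross w (evens v) (odds v)

    -- On all n = 2k indices this is n! ∇P_a / ∏_{i<j} z i j: the quotient by the alternating
    -- product ∏ z i j absorbs the signs of the antisymmetriser.
    S : (E → E → Carrier) → ℕ → List E → Carrier
    S a k N = Σarr (double k) N (term a)

    pairProd-PairSwap : ∀ a {u v} → PairSwap u v → pairProd a u ≈ pairProd a v
    pairProd-PairSwap a (here x y r s w) = solve 3 (λ a b c → a :* (b :* c) := b :* (a :* c)) refl _ _ _
    pairProd-PairSwap a (there x y p)    = *-congˡ (pairProd-PairSwap a p)

    term-PairSwap : ∀ a {u v} → PairSwap u v → term a u ≈ term a v
    term-PairSwap a {u} {v} p = *-cong (pairProd-PairSwap a p)
      (trans (cross-congˡ w (odds u) (PairSwap-evens p)) (cross-congʳ w (evens v) (PairSwap-odds p)))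

    -- The k numerators and the k² poles both contribute the sign (-1)^k, and the two signs cancel.
    term-flip : ∀ {a} → Plücker a → ∀ k v → length v ≡ double k → term a (flip v) ≈ term a v
    term-flip pl k v eq = trans
      (*-cong (pairProd-flip (Plücker.antisymmetric pl) k v eq) (cross-flip antiʷ k v eq))
      (trans (solve 3 (λ ε a c → (ε :* a) :* (ε :* c) := (ε :* ε) :* (a :* c)) refl _ _ _)
        (trans (*-congʳ (negOnePow-sq k)) (*-identityˡ _)))

    -- The factor `suc k` counts the places of the pair containing `n`. The factor two arises
    -- because flipping all pairs at once matches the words with `n` first in its pair to those with
    -- `n` second.
    S-∷ : ∀ {a} → Plücker a → ∀ k n N → length N ≡ suc (double k) →
      S a (suc k) (n ∷ N) ≈ fromℕR (suc k) * ((1# + 1#) * Σarr₁ (double k) N (λ p v → term a (p ∷ n ∷ v)))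
    S-∷ {a} pl k n N eq = trans (Σarr-∷ k n N (term a) (term-PairSwap a) eq) (*-congˡ (trans
      (+-congʳ (trans
        (Σarr₁-cong-length (double k) N (λ p v len → sym (term-flip pl (suc k) (n ∷ p ∷ v) (≡.cong (suc ∘ suc) len))))
        (Σarr₁-flip k N (λ p v → term a (p ∷ n ∷ v)))))
      (sym (trans (distribʳ _ _ _) (+-cong (*-identityˡ _) (*-identityˡ _))))))

    term-∷∷ : ∀ a n p v → term a (p ∷ n ∷ v) ≈
      (a p n * pairProd a v) * (cross w (p ∷ evens v) (odds v) * ∏ (λ x → w x n) (p ∷ evens v))
    term-∷∷ a n p v = *-congˡ (trans (cross-∷ʳ w (p ∷ evens v) n (odds v)) (*-comm _ _))

    -- This is the vanishing sum of partial fractions over the nodes `n ∷ T`, with the term at `n`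
    -- moved to the other side. Transposing its `w` and `z` factors gives signs that differ by one,
    -- since `T` has one element more than `J`, and this absorbs the minus sign.
    ∏-interpolate : ∀ n T J → Unique (n ∷ T) → length T ≡ suc (length J) →
      Σpick T (λ i us → ∏ (w i) us * (w i n * ∏ (z i) J)) ≈ ∏ (λ x → w x n) T * ∏ (λ j → z j n) J
    ∏-interpolate n T J uniq eq = begin
      Σpick T G                                   ≈⟨ solve 2 (λ x y → y := (x :+ y) :- x) refl F₀ _ ⟩
      (F₀ + Σpick T G) - F₀                       ≈⟨ +-congʳ (trans (+-congˡ (Σpick-cong T (λ i us →
                                                       solve 3 (λ a b c → a :* (b :* c) := (b :* a) :* c) refl _ _ _)))
                                                       (Σpick-partial-fractions plᶻ inv antiʷ (n ∷ T) J uniq (≡.cong suc eq))) ⟩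
      0# - F₀                                     ≈⟨ +-congˡ (-‿cong (*-cong
                                                       (∏-transpose antiʷ n (suc (length J)) T eq)
                                                       (∏-transpose (Plücker.antisymmetric plᶻ) n (length J) J ≡.refl))) ⟩
      0# - (- ε * W) * (ε * Z)                    ≈⟨ solve 3 (λ ε w z → con (ℤ.+ 0) :- (:- ε :* w) :* (ε :* z) := (ε :* ε) :* (w :* z)) refl _ _ _ ⟩
      (ε * ε) * (W * Z)                           ≈⟨ trans (*-congʳ (negOnePow-sq (length J))) (*-identityˡ _) ⟩
      W * Z                                       ∎
      where
      G : E → List E → Carrier
      G i us = ∏ (w i) us * (w i n * ∏ (z i) J)
      F₀ = ∏ (w n) T * ∏ (z n) J
      ε = negOnePow (length J)
      W = ∏ (λ x → w x n) T
      Z = ∏ (λ j → z j n) J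

    evens-Unique : ∀ (n p : E) v {N} → Unique (n ∷ N) → p ∷ v ↭ N → Unique (n ∷ p ∷ evens v)
    evens-Unique n p v uniq q = AllPairs-++⁻ˡ (n ∷ p ∷ evens v)
      (Unique-↭ (prep n (↭-trans (prep p (evens-odds-↭ v)) q)) uniq)

    -- Lagrange interpolation: S a (suc k) (n ∷ N) is read off from its residues at the poles i ∈ N,
    -- with k arbitrary test nodes J.
    S-interpolate : ∀ {a} → Plücker a → ∀ k n N J → length N ≡ suc (double k) → length J ≡ k → Unique (n ∷ N) →
      fromℕR (suc k) * (fromℕR (suc (suc k)) *
          Σpick N (λ i us → (a i n * w i n) * S a k us * (∏ (w i) us * ∏ (z i) J)))
        ≈ S a (suc k) (n ∷ N) * ∏ (λ j → z j n) J
    S-interpolate {a} pl k n N J eq eqJ uniq = begin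
      c₁ * (c₂ * Σpick N (λ i us → (a i n * w i n) * S a k us * (∏ (w i) us * ∏ (z i) J)))
        ≈⟨ *-congˡ (*-congˡ (Σpick-cong-↭ N (λ i us p → trans
             (solve 5 (λ a w s p z → (a :* w) :* s :* (p :* z) := ((a :* w) :* (p :* z)) :* s) refl _ _ _ _ _)
             (trans (sym (Σarr-*ˡ _ (double k) us (term a)))
               (Σarr-cong-↭ (double k) us (ℕ.suc-injective (≡.trans (↭-length p) eq)) (λ v q → trans
                 (*-congʳ (*-congˡ (*-congʳ (∏-↭ (w i) (↭-sym q)))))
                 (solve 6 (λ a w p z A c → ((a :* w) :* (p :* z)) :* (A :* c) := (a :* A) :* ((c :* p) :* (w :* z))) refl _ _ _ _ _ _))))))) ⟩
      c₁ * (c₂ * Σarr₁ (double k) N (λ i v → (a i n * pairProd a v) *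
        ((cross w (evens v) (odds v) * ∏ (w i) v) * (w i n * ∏ (z i) J))))
        -- The weight does not look at the remaining list, so the inner sum runs over the `k + 1`
        -- nodes `p ∷ evens v` against `k` test nodes, the balance that `∏-interpolate` asks for.
        ≈⟨ *-congˡ (Σarr₁-exchange-cross pl n antiʷ k N (λ i _ → w i n * ∏ (z i) J) (λ _ _ → refl)) ⟩
      c₁ * ((1# + 1#) * Σarr₁ (double k) N (λ p v → (a p n * pairProd a v) *
        (cross w (p ∷ evens v) (odds v) * Σpick (p ∷ evens v) (λ i us → ∏ (w i) us * (w i n * ∏ (z i) J)))))
        ≈⟨ *-congˡ (*-congˡ (Σarr₁-cong-↭ (double k) N eq (λ p v q → trans
             (*-congˡ (*-congˡ (∏-interpolate n (p ∷ evens v) J (evens-Unique n p v uniq q)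
               (≡.cong suc (≡.trans (length-evens k v (ℕ.suc-injective (≡.trans (↭-length q) eq))) (≡.sym eqJ))))))
             (trans (solve 4 (λ x c w z → x :* (c :* (w :* z)) := z :* (x :* (c :* w))) refl _ _ _ _)
               (*-congˡ (sym (term-∷∷ a n p v))))))) ⟩
      c₁ * ((1# + 1#) * Σarr₁ (double k) N (λ p v → Z * term a (p ∷ n ∷ v)))
        ≈⟨ *-congˡ (*-congˡ (Σarr₁-*ˡ Z (double k) N _)) ⟩
      c₁ * ((1# + 1#) * (Z * Σarr₁ (double k) N (λ p v → term a (p ∷ n ∷ v))))
        ≈⟨ solve 4 (λ c t z s → c :* (t :* (z :* s)) := (c :* (t :* s)) :* z) refl _ _ _ _ ⟩
      (c₁ * ((1# + 1#) * Σarr₁ (double k) N (λ p v → term a (p ∷ n ∷ v)))) * Z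
        ≈⟨ *-congʳ (S-∷ pl k n N eq) ⟨
      S a (suc k) (n ∷ N) * Z ∎
      where
      c₁ = fromℕR (suc k)
      c₂ = fromℕR (suc (suc k))
      Z = ∏ (λ j → z j n) J

    -- The Pfaffian of a b / z divided by ∏_{i<j} z i j, expanded along its first row.
    Q : (E → E → Carrier) → (E → E → Carrier) → ℕ → List E → Carrier
    Q a b zero    _       = 1#
    Q a b (suc k) []      = 0#
    Q a b (suc k) (n ∷ N) = Σpick N (λ i us → (a n i * b n i * w n i) * (∏ (w n) (i ∷ us) * ∏ (w i) us) * Q a b k us)

    ∏-diag : ∀ i {us J} → i ∷ us ↭ J → ∏ (z i) J ≈ 0#
    ∏-diag i p = trans (∏-↭ (z i) (↭-sym p)) (trans (*-congʳ (Plücker.diag plᶻ i)) (zeroˡ _))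

    ∏-inv : ∀ i xs → All (i ≢_) xs → ∏ (w i) xs * ∏ (z i) xs ≈ 1#
    ∏-inv i []       []       = *-identityˡ _
    ∏-inv i (x ∷ xs) (p ∷ ps) = trans
      (solve 4 (λ a b c d → (a :* b) :* (c :* d) := (c :* a) :* (b :* d)) refl _ _ _ _)
      (trans (*-cong (inv i x p) (∏-inv i xs ps)) (*-identityˡ _))

    ∏-inv′ : ∀ n xs → All (n ≢_) xs → ∏ (λ x → w x n) xs * ∏ (λ x → z x n) xs ≈ 1#
    ∏-inv′ n []       []       = *-identityˡ _
    ∏-inv′ n (x ∷ xs) (p ∷ ps) = trans
      (solve 4 (λ a b c d → (a :* b) :* (c :* d) := (c :* a) :* (b :* d)) refl _ _ _ _)
      (trans (*-cong (inv x n (≡.≢-sym p)) (∏-inv′ n xs ps)) (*-identityˡ _))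

    Unique-++⇒≢ : ∀ {i : E} {us} J → Unique (i ∷ us ++ J) → All (i ≢_) J
    Unique-++⇒≢ {us = us} J (p ∷ _) = All.++⁻ʳ us p

    -- When the test nodes are taken from `N` itself, the terms with `i` in `J` vanish through
    -- `z i i`, and for the others `∏ (z i) J` cancels the poles at `J`. What remains is exactly the
    -- sum over `i` that the exchange for `b` leaves behind.
    S-interpolate-cancelled : ∀ {a} → Plücker a → ∀ k n M J {N} → length N ≡ suc (double k) → length J ≡ k →
      Unique (n ∷ N) → M ++ J ↭ N →
      fromℕR (suc k) * (fromℕR (suc (suc k)) *
          Σpick M (λ i us → ∏ (w i) us * ((a i n * w i n) * S a k (us ++ J))))
        ≈ S a (suc k) (n ∷ N) * ∏ (λ j → z j n) J
    S-interpolate-cancelled {a} pl k n M J {N} eq eqJ uniq p = trans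
      (*-congˡ (*-congˡ (begin
        Σpick M (λ i us → ∏ (w i) us * ((a i n * w i n) * S a k (us ++ J)))
          ≈⟨ trans (sym (+-identityʳ _)) (+-cong
               (Σpick-cong-↭ M (λ i us q → sym (trans
                 (*-congˡ (trans (*-congʳ (∏-++ (w i) us J)) (trans (*-assoc _ _ _)
                   (trans (*-congˡ (∏-inv i J (Unique-++⇒≢ {i} {us} J
                     (Unique-↭ (↭-trans (++⁺ʳ J q) p) (AllPairs.tail uniq))))) (*-identityʳ _)))))
                 (*-comm _ _))))
               (sym (trans (Σpick-cong-↭ J {G = λ _ _ → 0#} (λ i us q → trans (*-congˡ (trans (*-congˡ (∏-diag i q)) (zeroʳ _))) (zeroʳ _)))
                 (Σpick-zero J (λ _ _ → refl))))) ⟩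
        Σpick M (λ i us → F i (us ++ J)) + Σpick J (λ i us → F i (M ++ us))
          ≈⟨ Σpick-++ M J F ⟨
        Σpick (M ++ J) F
          ≈⟨ Σpick-↭ (λ i q → *-cong (*-congˡ (Σarr-↭ (double k) (term a) q)) (*-congʳ (∏-↭ (w i) q))) p ⟩
        Σpick N F ∎)))
      (S-interpolate pl k n N J eq eqJ uniq)
      where
      F : E → List E → Carrier
      F i us = (a i n * w i n) * S a k us * (∏ (w i) us * ∏ (z i) J)

    negOnePow-double : ∀ k → negOnePow (double k) ≈ 1#
    negOnePow-double zero    = refl
    negOnePow-double (suc k) = trans (solve 1 (λ x → :- :- x := x) refl _) (negOnePow-double k)

    Q-factorises : ∀ {a b} → Plücker a → Plücker b → ∀ k N → length N ≡ double k → Unique N →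
      coefficient k * coefficient k * Q a b k N ≈ S a k N * S b k N
    Q-factorises plᵃ plᵇ zero [] eq uniq =
      trans (*-cong (*-identityˡ _) refl) (trans (*-identityˡ _) (sym (trans (*-cong (*-identityˡ _) (*-identityˡ _)) (*-identityˡ _))))
    Q-factorises {a} {b} plᵃ plᵇ (suc k) (n ∷ N) eq uniq@(n∉N ∷ _) = begin
      (c₁ * c₂ * κ) * (c₁ * c₂ * κ) * Σpick N (λ i us → g i us * Q a b k us)
        -- The isolated `c₂` pays for the exchange in `b`. Of the remaining constants, `c₁ * c₂`
        -- pays for the interpolation of the `a`-sum and the last `c₁` is the one in `S-∷` for `b`.
        ≈⟨ solve 4 (λ c d k q → (c :* d :* k) :* (c :* d :* k) :* q := (c :* d :* c) :* (d :* ((k :* k) :* q))) refl _ _ _ _ ⟩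
      (c₁ * c₂ * c₁) * (c₂ * ((κ * κ) * Σpick N (λ i us → g i us * Q a b k us)))
        ≈⟨ *-congˡ (*-congˡ (trans (sym (Σpick-*ˡ (κ * κ) N _)) (Σpick-cong-↭ N step))) ⟩
      (c₁ * c₂ * c₁) * (c₂ * Σarr₁ (double k) N (λ i v → (b i n * pairProd b v) *
        ((cross w (evens v) (odds v) * ∏ (w i) v) * (- ω * ((a i n * w i n) * S a k v)))))
        -- From here on the `b` factors depend on `p` and `v` alone; the inner sum over `i` contains
        -- only `a` and the poles.
        ≈⟨ *-congˡ (Σarr₁-exchange-cross plᵇ n antiʷ k N (λ i us → - ω * ((a i n * w i n) * S a k us))
             (λ i q → *-congˡ (*-congˡ (Σarr-↭ (double k) (term a) q)))) ⟩
      (c₁ * c₂ * c₁) * ((1# + 1#) * Σarr₁ (double k) N (λ p v → (b p n * pairProd b v) *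
        (cross w (p ∷ evens v) (odds v) *
          Σpick (p ∷ evens v) (λ i us → ∏ (w i) us * (- ω * ((a i n * w i n) * S a k (us ++ odds v)))))))
        ≈⟨ solve 4 (λ c d t s → (c :* d :* c) :* (t :* s) := c :* (t :* ((c :* d) :* s))) refl _ _ _ _ ⟩
      c₁ * ((1# + 1#) * ((c₁ * c₂) * Σarr₁ (double k) N (λ p v → (b p n * pairProd b v) *
        (cross w (p ∷ evens v) (odds v) *
          Σpick (p ∷ evens v) (λ i us → ∏ (w i) us * (- ω * ((a i n * w i n) * S a k (us ++ odds v))))))))
        ≈⟨ *-congˡ (*-congˡ (trans (sym (Σarr₁-*ˡ (c₁ * c₂) (double k) N _)) (trans
             (Σarr₁-cong-↭ (double k) N len collect) (Σarr₁-*ˡ (S a (suc k) (n ∷ N)) (double k) N _)))) ⟩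
      c₁ * ((1# + 1#) * (S a (suc k) (n ∷ N) * Σarr₁ (double k) N (λ p v → term b (p ∷ n ∷ v))))
        ≈⟨ solve 4 (λ c t a s → c :* (t :* (a :* s)) := a :* (c :* (t :* s))) refl _ _ _ _ ⟩
      S a (suc k) (n ∷ N) * (c₁ * ((1# + 1#) * Σarr₁ (double k) N (λ p v → term b (p ∷ n ∷ v))))
        ≈⟨ *-congˡ (S-∷ plᵇ k n N len) ⟨
      S a (suc k) (n ∷ N) * S b (suc k) (n ∷ N) ∎
      where
      c₁ = fromℕR (suc k)
      c₂ = fromℕR (suc (suc k))
      κ = coefficient k
      ω = ∏ (w n) N
      len : length N ≡ suc (double k)
      len = ℕ.suc-injective eq
      g : E → List E → Carrier
      g i us = (a n i * b n i * w n i) * (∏ (w n) (i ∷ us) * ∏ (w i) us)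
      step : ∀ i us → i ∷ us ↭ N → (κ * κ) * (g i us * Q a b k us) ≈
        Σarr (double k) us (λ v → (b i n * pairProd b v) *
          ((cross w (evens v) (odds v) * ∏ (w i) v) * (- ω * ((a i n * w i n) * S a k v))))
      step i us p = begin
        (κ * κ) * (g i us * Q a b k us)
          ≈⟨ solve 3 (λ k g q → k :* (g :* q) := g :* (k :* q)) refl _ _ _ ⟩
        g i us * (κ * κ * Q a b k us)
          -- Turning `n i` into `i n` in the three factors `a`, `b`, `w` yields one minus sign,
          -- which is kept attached to `ω`.
          ≈⟨ *-cong
               (*-cong (*-cong (*-cong (Plücker.antisym plᵃ n i) (Plücker.antisym plᵇ n i)) (Antisymmetric.antisym antiʷ n i))
                 (*-congʳ (∏-↭ (w n) p)))
               (Q-factorises plᵃ plᵇ k us len′ (AllPairs.tail (Unique-↭ p (AllPairs.tail uniq)))) ⟩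
        ((- a i n * - b i n * - w i n) * (ω * ∏ (w i) us)) * (S a k us * S b k us)
          ≈⟨ solve 7 (λ a b w ω p s t → ((:- a :* :- b :* :- w) :* (ω :* p)) :* (s :* t) :=
               (b :* (p :* (:- ω :* ((a :* w) :* s)))) :* t) refl _ _ _ _ _ _ _ ⟩
        (b i n * (∏ (w i) us * (- ω * ((a i n * w i n) * S a k us)))) * S b k us
          ≈⟨ Σarr-*ˡ _ (double k) us (term b) ⟨
        Σarr (double k) us (λ v → (b i n * (∏ (w i) us * (- ω * ((a i n * w i n) * S a k us)))) * term b v)
          ≈⟨ Σarr-cong-↭ (double k) us len′ (λ v q → trans
               (*-congʳ (*-congˡ (*-cong (∏-↭ (w i) (↭-sym q)) (*-congˡ (*-congˡ (Σarr-↭ (double k) (term a) (↭-sym q)))))))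
               (solve 5 (λ b p x B c → (b :* (p :* x)) :* (B :* c) := (b :* B) :* ((c :* p) :* x)) refl _ _ _ _ _)) ⟩
        Σarr (double k) us (λ v → (b i n * pairProd b v) *
          ((cross w (evens v) (odds v) * ∏ (w i) v) * (- ω * ((a i n * w i n) * S a k v)))) ∎
        where
        len′ : length us ≡ double k
        len′ = ℕ.suc-injective (≡.trans (↭-length p) len)
      collect : ∀ p v → p ∷ v ↭ N →
        (c₁ * c₂) * ((b p n * pairProd b v) * (cross w (p ∷ evens v) (odds v) *
          Σpick (p ∷ evens v) (λ i us → ∏ (w i) us * (- ω * ((a i n * w i n) * S a k (us ++ odds v)))))) ≈
        S a (suc k) (n ∷ N) * term b (p ∷ n ∷ v)
      collect p v q = begin
        (c₁ * c₂) * (B * (X * Σpick M (λ i us → ∏ (w i) us * (- ω * ((a i n * w i n) * S a k (us ++ J))))))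
          ≈⟨ *-congˡ (*-congˡ (*-congˡ (trans
               (Σpick-cong M {G = λ i us → - ω * G i us} (λ i us → solve 3 (λ p ω s → p :* (ω :* s) := ω :* (p :* s)) refl _ _ _))
               (Σpick-*ˡ (- ω) M G)))) ⟩
        (c₁ * c₂) * (B * (X * (- ω * Σpick M G)))
          ≈⟨ solve 6 (λ c d b x ω s → (c :* d) :* (b :* (x :* (:- ω :* s))) := (b :* (x :* :- ω)) :* (c :* (d :* s))) refl _ _ _ _ _ _ ⟩
        (B * (X * - ω)) * (c₁ * (c₂ * Σpick M G))
          -- The second entries `J` of the word for `b` serve as test nodes. The factor `Zᴶ` that
          -- interpolation leaves is cancelled by the part `Wᴶ` of `ω`, and the other part `W`
          -- completes the term of `p ∷ n ∷ v`.
          ≈⟨ *-cong (*-congˡ (*-congˡ (-‿cong ω-split)))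
               (S-interpolate-cancelled plᵃ k n M J len (length-odds k v (ℕ.suc-injective (≡.trans (↭-length q) len))) uniq MJ) ⟩
        (B * (X * - (- (W * Wᴶ)))) * (Sᴺ * Zᴶ)
          ≈⟨ solve 6 (λ b x w v s z → (b :* (x :* :- :- (w :* v))) :* (s :* z) := (s :* (b :* (x :* w))) :* (v :* z)) refl _ _ _ _ _ _ ⟩
        (Sᴺ * (B * (X * W))) * (Wᴶ * Zᴶ)
          ≈⟨ trans (*-congˡ (∏-inv′ n J (All.++⁻ʳ M (All-resp-↭ (↭-sym MJ) n∉N)))) (*-identityʳ _) ⟩
        Sᴺ * (B * (X * W))
          ≈⟨ *-congˡ (term-∷∷ b n p v) ⟨
        Sᴺ * term b (p ∷ n ∷ v) ∎
        where
        M = p ∷ evens v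
        J = odds v
        B = b p n * pairProd b v
        X = cross w M J
        Sᴺ = S a (suc k) (n ∷ N)
        W = ∏ (λ x → w x n) M
        Wᴶ = ∏ (λ x → w x n) J
        Zᴶ = ∏ (λ x → z x n) J
        G : E → List E → Carrier
        G i us = ∏ (w i) us * ((a i n * w i n) * S a k (us ++ J))
        MJ : M ++ J ↭ N
        MJ = ↭-trans (prep p (evens-odds-↭ v)) q
        -- The length `2k + 1` of `N` is odd, so transposing all factors gives a minus sign, which
        -- offsets the one attached to `ω`.
        ω-split : ω ≈ - (W * Wᴶ)
        ω-split = begin
          ω                              ≈⟨ ∏-transpose antiʷ n (suc (double k)) N len ⟩
          - negOnePow (double k) * ∏ (λ x → w x n) N
                                         ≈⟨ *-cong (-‿cong (negOnePow-double k)) (trans (∏-↭ _ (↭-sym MJ)) (∏-++ _ M J)) ⟩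
          - 1# * (W * Wᴶ)                ≈⟨ solve 2 (λ o x → :- o :* x := :- (o :* x)) refl 1# (W * Wᴶ) ⟩
          - (1# * (W * Wᴶ))              ≈⟨ -‿cong (*-identityˡ _) ⟩
          - (W * Wᴶ)                     ∎

-- Permutations and matchings encoded as words

module Enumeration where
  open ≡ using (refl; cong; cong₂; sym; trans; module ≡-Reasoning)

  pairs : ∀ {a} {A : Set a} → List A → List (A × A)
  pairs []       = []
  pairs (x ∷ xs) = map (x ,_) xs ++ pairs xs

  filterᵇ-map : ∀ {a b} {A : Set a} {B : Set b} (p : B → Bool) (f : A → B) xs →
    filterᵇ p (map f xs) ≡ map f (filterᵇ (p ∘ f) xs)
  filterᵇ-map p f []       = refl
  filterᵇ-map p f (x ∷ xs) with p (f x)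
  ... | true  = cong (f x ∷_) (filterᵇ-map p f xs)
  ... | false = filterᵇ-map p f xs

  filterᵇ-true : ∀ {a} {A : Set a} (xs : List A) → filterᵇ (λ _ → true) xs ≡ xs
  filterᵇ-true []       = refl
  filterᵇ-true (x ∷ xs) = cong (x ∷_) (filterᵇ-true xs)

  filterᵇ-cong : ∀ {a} {A : Set a} {p q : A → Bool} → (∀ x → p x ≡ q x) → ∀ xs → filterᵇ p xs ≡ filterᵇ q xs
  filterᵇ-cong h []       = refl
  filterᵇ-cong {p = p} {q} h (x ∷ xs) with p x | q x | h x
  ... | true  | true  | _ = cong (x ∷_) (filterᵇ-cong h xs)
  ... | false | false | _ = filterᵇ-cong h xs

  allFin-suc : ∀ n → tabulate {n = n} Fin.suc ≡ map Fin.suc (allFin n)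
  allFin-suc n = sym (map-tabulate (λ i → i) Fin.suc)

  pairsLt-suc : ∀ n → pairsLt (suc n) ≡
    map (Fin.zero ,_) (map Fin.suc (allFin n)) ++ map (Product.map Fin.suc Fin.suc) (pairsLt n)
  pairsLt-suc n = cong₂ _++_ head-row (begin
    concatMap row (tabulate Fin.suc)
      ≡⟨ cong (concatMap row) (allFin-suc n) ⟩
    concatMap row (map Fin.suc (allFin n))
      ≡⟨ concatMap-map row Fin.suc (allFin n) ⟩
    concatMap (row ∘ Fin.suc) (allFin n)
      ≡⟨ concatMap-cong suc-row (allFin n) ⟩
    concatMap (map (Product.map Fin.suc Fin.suc) ∘ row′) (allFin n)
      ≡⟨ map-concatMap (Product.map Fin.suc Fin.suc) row′ (allFin n) ⟨
    map (Product.map Fin.suc Fin.suc) (pairsLt n) ∎)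
    where
    open ≡-Reasoning
    row : Fin (suc n) → List (Fin (suc n) × Fin (suc n))
    row i = map (i ,_) (filterᵇ (λ j → toℕ i <ᵇ toℕ j) (allFin (suc n)))
    row′ : Fin n → List (Fin n × Fin n)
    row′ i = map (i ,_) (filterᵇ (λ j → toℕ i <ᵇ toℕ j) (allFin n))
    head-row : row Fin.zero ≡ map (Fin.zero ,_) (map Fin.suc (allFin n))
    head-row = cong (map (Fin.zero ,_)) (trans
      (cong (filterᵇ (λ j → 0 <ᵇ toℕ j)) (allFin-suc n))
      (trans (filterᵇ-map (λ j → 0 <ᵇ toℕ j) Fin.suc (allFin n)) (cong (map Fin.suc) (filterᵇ-true (allFin n)))))
    suc-row : ∀ i → row (Fin.suc i) ≡ map (Product.map Fin.suc Fin.suc) (row′ i)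
    suc-row i = begin
      map (Fin.suc i ,_) (filterᵇ (λ j → suc (toℕ i) <ᵇ toℕ j) (tabulate Fin.suc))
        ≡⟨ cong (map (Fin.suc i ,_) ∘ filterᵇ (λ j → suc (toℕ i) <ᵇ toℕ j)) (allFin-suc n) ⟩
      map (Fin.suc i ,_) (filterᵇ (λ j → suc (toℕ i) <ᵇ toℕ j) (map Fin.suc (allFin n)))
        ≡⟨ cong (map (Fin.suc i ,_)) (filterᵇ-map (λ j → suc (toℕ i) <ᵇ toℕ j) Fin.suc (allFin n)) ⟩
      map (Fin.suc i ,_) (map Fin.suc (filterᵇ (λ j → toℕ i <ᵇ toℕ j) (allFin n)))
        ≡⟨ map-∘ _ ⟨
      map (λ j → Fin.suc i , Fin.suc j) (filterᵇ (λ j → toℕ i <ᵇ toℕ j) (allFin n))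
        ≡⟨ map-∘ _ ⟩
      map (Product.map Fin.suc Fin.suc) (row′ i) ∎

  pairsLt-tabulate : ∀ {a} {A : Set a} {n} (f : Fin n → A) → map (Product.map f f) (pairsLt n) ≡ pairs (tabulate f)
  pairsLt-tabulate {n = zero}  f = refl
  pairsLt-tabulate {n = suc n} f = begin
    map (Product.map f f) (pairsLt (suc n))
      ≡⟨ cong (map (Product.map f f)) (pairsLt-suc n) ⟩
    map (Product.map f f) (map (Fin.zero ,_) (map Fin.suc (allFin n)) ++ map (Product.map Fin.suc Fin.suc) (pairsLt n))
      ≡⟨ map-++ (Product.map f f) (map (Fin.zero ,_) (map Fin.suc (allFin n))) _ ⟩
    map (Product.map f f) (map (Fin.zero ,_) (map Fin.suc (allFin n))) ++
      map (Product.map f f) (map (Product.map Fin.suc Fin.suc) (pairsLt n))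
      ≡⟨ cong₂ _++_
           (trans (sym (trans (map-∘ (allFin n)) (map-∘ (map Fin.suc (allFin n)))))
             (trans (map-tabulate (λ i → i) (λ j → f Fin.zero , f (Fin.suc j))) (sym (map-tabulate (f ∘ Fin.suc) (f Fin.zero ,_)))))
           (trans (sym (map-∘ (pairsLt n))) (pairsLt-tabulate (f ∘ Fin.suc))) ⟩
    map (f Fin.zero ,_) (tabulate (f ∘ Fin.suc)) ++ pairs (tabulate (f ∘ Fin.suc)) ∎
    where open ≡-Reasoning

  module _ {n : ℕ} where
    distinctᵇ : List (Fin n) → Bool
    distinctᵇ v = and (map (λ p → not (does (proj₁ p Fin.≟ proj₂ p))) (pairs v))

    avoidsᵇ : Fin n → List (Fin n) → Bool
    avoidsᵇ x v = and (map (λ y → not (does (x Fin.≟ y))) v)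

    descents : List (Fin n) → ℕ
    descents v = length (filterᵇ (λ p → toℕ (proj₂ p) <ᵇ toℕ (proj₁ p)) (pairs v))

    injectiveᵇ-tabulate : ∀ (σ : Fin n → Fin n) → injectiveᵇ σ ≡ distinctᵇ (tabulate σ)
    injectiveᵇ-tabulate σ = cong and (trans (map-∘ (pairsLt n)) (cong (map _) (pairsLt-tabulate σ)))

    inversions-tabulate : ∀ (σ : Fin n → Fin n) → inversions σ ≡ descents (tabulate σ)
    inversions-tabulate σ = begin
      inversions σ                                                        ≡⟨ length-map (Product.map σ σ) (filterᵇ _ (pairsLt n)) ⟨
      length (map (Product.map σ σ) (filterᵇ _ (pairsLt n)))              ≡⟨ cong length (filterᵇ-map descent (Product.map σ σ) (pairsLt n)) ⟨
      length (filterᵇ descent (map (Product.map σ σ) (pairsLt n)))        ≡⟨ cong (length ∘ filterᵇ descent) (pairsLt-tabulate σ) ⟩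
      descents (tabulate σ)                                               ∎
      where
      open ≡-Reasoning
      descent : Fin n × Fin n → Bool
      descent p = toℕ (proj₂ p) <ᵇ toℕ (proj₁ p)

    words : ℕ → List (Fin n) → List (List (Fin n))
    words zero    B = [] ∷ []
    words (suc k) B = concatMap (λ x → map (x ∷_) (words k B)) B

    -- Under `tabulate`, `consF` becomes list consing by computation, and lists of values can be
    -- identified propositionally without function extensionality. All sums over permutations are
    -- transported to words in this way.
    allFuns-words : ∀ k → map tabulate (allFuns k n) ≡ words k (allFin n)
    allFuns-words zero    = refl
    allFuns-words (suc k) = trans (map-concatMap tabulate _ (allFin n)) (concatMap-cong (λ x → begin
      map tabulate (map (consF x) (allFuns k n))   ≡⟨ map-∘ (allFuns k n) ⟨
      map (λ f → x ∷ tabulate f) (allFuns k n)     ≡⟨ map-∘ (allFuns k n) ⟩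
      map (x ∷_) (map tabulate (allFuns k n))      ≡⟨ cong (map (x ∷_)) (allFuns-words k) ⟩
      map (x ∷_) (words k (allFin n))              ∎) (allFin n))
      where open ≡-Reasoning

    Perms-words : map tabulate (Perms n) ≡ filterᵇ distinctᵇ (words n (allFin n))
    Perms-words = begin
      map tabulate (filterᵇ injectiveᵇ (allFuns n n))               ≡⟨ cong (map tabulate) (filterᵇ-cong injectiveᵇ-tabulate (allFuns n n)) ⟩
      map tabulate (filterᵇ (distinctᵇ ∘ tabulate) (allFuns n n))   ≡⟨ filterᵇ-map distinctᵇ tabulate (allFuns n n) ⟨
      filterᵇ distinctᵇ (map tabulate (allFuns n n))                ≡⟨ cong (filterᵇ distinctᵇ) (allFuns-words n) ⟩
      filterᵇ distinctᵇ (words n (allFin n))                        ∎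
      where open ≡-Reasoning

  and-++ : ∀ xs ys → and (xs ++ ys) ≡ and xs ∧ and ys
  and-++ []       ys = refl
  and-++ (x ∷ xs) ys = trans (cong (x ∧_) (and-++ xs ys)) (sym (∧-assoc x (and xs) (and ys)))

  distinctᵇ-∷ : ∀ {n} (x : Fin n) v → distinctᵇ (x ∷ v) ≡ avoidsᵇ x v ∧ distinctᵇ v
  distinctᵇ-∷ x v = trans
    (cong and (map-++ _ (map (x ,_) v) (pairs v)))
    (trans (and-++ (map _ (map (x ,_) v)) (map _ (pairs v)))
      (cong (λ l → and l ∧ distinctᵇ v) (sym (map-∘ v))))

  module _ {a : Level} {A : Set a} where
    tabulate-++ : ∀ m {n} (f : Fin (m ℕ.+ n) → A) →
      tabulate f ≡ tabulate (λ i → f (i ↑ˡ n)) ++ tabulate (λ i → f (m ↑ʳ i))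
    tabulate-++ zero    f = refl
    tabulate-++ (suc m) f = cong (f Fin.zero ∷_) (tabulate-++ m (f ∘ Fin.suc))

    take-length-++ : ∀ {k} (xs ys : List A) → length xs ≡ k → take k (xs ++ ys) ≡ xs
    take-length-++ []       ys refl = refl
    take-length-++ (x ∷ xs) ys refl = cong (x ∷_) (take-length-++ xs ys refl)

    drop-length-++ : ∀ {k} (xs ys : List A) → length xs ≡ k → drop k (xs ++ ys) ≡ ys
    drop-length-++ []       ys refl = refl
    drop-length-++ (x ∷ xs) ys refl = drop-length-++ xs ys refl

    take-tabulate : ∀ m {n} (f : Fin (m ℕ.+ n) → A) → take m (tabulate f) ≡ tabulate (λ i → f (i ↑ˡ n))
    take-tabulate m f = trans (cong (take m) (tabulate-++ m f)) (take-length-++ _ _ (length-tabulate _))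

    drop-tabulate : ∀ m {n} (f : Fin (m ℕ.+ n) → A) → drop m (tabulate f) ≡ tabulate (λ i → f (m ↑ʳ i))
    drop-tabulate m {n} f = trans (cong (drop m) (tabulate-++ m f))
      (drop-length-++ (tabulate (λ i → f (i ↑ˡ n))) _ (length-tabulate (λ i → f (i ↑ˡ n))))

    take-insertAt : ∀ k x (w : List A) → k ℕ.≤ length w → take k (insertAt k x w) ≡ take k w
    take-insertAt zero    x w       _            = refl
    take-insertAt (suc k) x (y ∷ w) (ℕ.s≤s k≤) = cong (y ∷_) (take-insertAt k x w k≤)

    drop-insertAt : ∀ k x (w : List A) → k ℕ.≤ length w → drop k (insertAt k x w) ≡ x ∷ drop k w
    drop-insertAt zero    x w       _            = refl
    drop-insertAt (suc k) x (y ∷ w) (ℕ.s≤s k≤) = drop-insertAt k x w k≤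

    private
      Fin-pred₂ : ∀ {n k} (i : Fin (suc (suc n))) → toℕ i ≡ suc (suc k) → Fin n
      Fin-pred₂ (Fin.suc (Fin.suc i)) _ = i

      Fin-pred₂-toℕ : ∀ {n k} (i : Fin (suc (suc n))) (eq : toℕ i ≡ suc (suc k)) → toℕ (Fin-pred₂ i eq) ≡ k
      Fin-pred₂-toℕ (Fin.suc (Fin.suc i)) eq = ℕ.suc-injective (ℕ.suc-injective eq)

      Fin-suc²-pred₂ : ∀ {n k} (i : Fin (suc (suc n))) (eq : toℕ i ≡ suc (suc k)) → i ≡ Fin.suc (Fin.suc (Fin-pred₂ i eq))
      Fin-suc²-pred₂ (Fin.suc (Fin.suc i)) _ = refl

    -- The length and the positions are described by equations, because `m + m` does not expose two
    -- successors and `evenPos`, built with `fromℕ<`, does not follow the recursion definitionally.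
    evens-tabulate : ∀ m {n} → n ≡ m ℕ.+ m → (f : Fin n → A) (ι : Fin m → Fin n) →
      (∀ k → toℕ (ι k) ≡ toℕ k ℕ.+ toℕ k) → tabulate (f ∘ ι) ≡ evens (tabulate f)
    evens-tabulate zero    {zero}  eq f ι h = refl
    evens-tabulate (suc m) {suc zero} eq f ι h with () ← trans (ℕ.suc-injective eq) (ℕ.+-suc m m)
    evens-tabulate (suc m) {suc (suc n)} eq f ι h = cong₂ _∷_
      (cong f (Fin.toℕ-injective (h Fin.zero)))
      (trans (tabulate-cong (λ k → cong f (Fin-suc²-pred₂ (ι (Fin.suc k)) (h′ k))))
        (evens-tabulate m (ℕ.suc-injective (trans (ℕ.suc-injective eq) (ℕ.+-suc m m))) (f ∘ Fin.suc ∘ Fin.suc)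
          (λ k → Fin-pred₂ (ι (Fin.suc k)) (h′ k)) (λ k → Fin-pred₂-toℕ (ι (Fin.suc k)) (h′ k))))
      where
      h′ : ∀ k → toℕ (ι (Fin.suc k)) ≡ suc (suc (toℕ k ℕ.+ toℕ k))
      h′ k = trans (h (Fin.suc k)) (cong suc (ℕ.+-suc (toℕ k) (toℕ k)))

    odds-tabulate : ∀ m {n} → n ≡ m ℕ.+ m → (f : Fin n → A) (ι : Fin m → Fin n) →
      (∀ k → toℕ (ι k) ≡ suc (toℕ k ℕ.+ toℕ k)) → tabulate (f ∘ ι) ≡ odds (tabulate f)
    odds-tabulate zero    {zero}  eq f ι h = refl
    odds-tabulate (suc m) {suc zero} eq f ι h with () ← trans (ℕ.suc-injective eq) (ℕ.+-suc m m)
    odds-tabulate (suc m) {suc (suc n)} eq f ι h = cong₂ _∷_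
      (cong f (Fin.toℕ-injective (h Fin.zero)))
      (trans (tabulate-cong (λ k → cong f (Fin-suc²-pred₂ (ι (Fin.suc k)) (h′ k))))
        (odds-tabulate m (ℕ.suc-injective (trans (ℕ.suc-injective eq) (ℕ.+-suc m m))) (f ∘ Fin.suc ∘ Fin.suc)
          (λ k → Fin-pred₂ (ι (Fin.suc k)) (h′ k)) (λ k → Fin-pred₂-toℕ (ι (Fin.suc k)) (h′ k))))
      where
      h′ : ∀ k → toℕ (ι (Fin.suc k)) ≡ suc (suc (suc (toℕ k ℕ.+ toℕ k)))
      h′ k = trans (h (Fin.suc k)) (cong (suc ∘ suc) (ℕ.+-suc (toℕ k) (toℕ k)))

    zipWith-tabulate : ∀ {b c} {B : Set b} {C : Set c} {n} (g : A → B → C) (f : Fin n → A) (h : Fin n → B) →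
      zipWith g (tabulate f) (tabulate h) ≡ map (λ k → g (f k) (h k)) (allFin n)
    zipWith-tabulate g f h = trans (go g f h) (sym (map-tabulate (λ i → i) (λ k → g (f k) (h k))))
      where
      go : ∀ {b c} {B : Set b} {C : Set c} {n} (g : A → B → C) (f : Fin n → A) (h : Fin n → B) →
        zipWith g (tabulate f) (tabulate h) ≡ tabulate (λ k → g (f k) (h k))
      go {n = zero}  g f h = refl
      go {n = suc n} g f h = cong (g (f Fin.zero) (h Fin.zero) ∷_) (go g (f ∘ Fin.suc) (h ∘ Fin.suc))

  isMatchingᵇ : ∀ {n} → List (Fin n) → Bool
  isMatchingᵇ v = and (zipWith (λ x y → toℕ x <ᵇ toℕ y) (evens v) (odds v))
    ∧ and (map (λ p → toℕ (proj₁ p) <ᵇ toℕ (proj₂ p)) (pairs (evens v)))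

  tabulate-evenPos : ∀ m {a} {A : Set a} (σ : Fin (m ℕ.+ m) → A) → tabulate (σ ∘ evenPos) ≡ evens (tabulate σ)
  tabulate-evenPos m σ = evens-tabulate m refl σ evenPos (λ k → Fin.toℕ-fromℕ< _)

  tabulate-oddPos : ∀ m {a} {A : Set a} (σ : Fin (m ℕ.+ m) → A) → tabulate (σ ∘ oddPos) ≡ odds (tabulate σ)
  tabulate-oddPos m σ = odds-tabulate m refl σ oddPos (λ k → Fin.toℕ-fromℕ< _)

  isMatchingPerm-tabulate : ∀ m (σ : Fin (m ℕ.+ m) → Fin (m ℕ.+ m)) → isMatchingPerm m σ ≡ isMatchingᵇ (tabulate σ)
  isMatchingPerm-tabulate m σ = cong₂ _∧_
    (cong and (trans (sym (zipWith-tabulate (λ x y → toℕ x <ᵇ toℕ y) (σ ∘ evenPos) (σ ∘ oddPos)))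
      (cong₂ (zipWith (λ x y → toℕ x <ᵇ toℕ y)) (tabulate-evenPos m σ) (tabulate-oddPos m σ))))
    (cong and (trans (map-∘ (pairsLt m)) (cong (map _) (trans (pairsLt-tabulate (σ ∘ evenPos)) (cong pairs (tabulate-evenPos m σ))))))

open Enumeration

-- From sums over permutations to sums over arrangements

module FiniteSums {c ℓ : Level} (R : CommutativeRing c ℓ) where
  open CommutativeRing R
  open RingDefs R using (sumR)
  open IntegerSolver R
  open SetoidReasoning setoid

  ∑ : ∀ {a} {A : Set a} → (A → Carrier) → List A → Carrier
  ∑ f xs = sumR (map f xs)

  infixr 5 _when_
  _when_ : Carrier → Bool → Carrier
  x when b = if b then x else 0#

  when-cong : ∀ b {x y} → x ≈ y → x when b ≈ y when b
  when-cong true  h = h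
  when-cong false h = refl

  when-*ˡ : ∀ b t x → t * x when b ≈ t * (x when b)
  when-*ˡ true  t x = refl
  when-*ˡ false t x = sym (zeroʳ t)

  when-∧ : ∀ b b′ x → x when (b ∧ b′) ≈ (x when b′) when b
  when-∧ true  b′ x = refl
  when-∧ false b′ x = refl

  module _ {a : Level} {A : Set a} where
    ∑-cong : ∀ xs {f g : A → Carrier} → (∀ x → f x ≈ g x) → ∑ f xs ≈ ∑ g xs
    ∑-cong []       h = refl
    ∑-cong (x ∷ xs) h = +-cong (h x) (∑-cong xs h)

    ∑-++ : ∀ (f : A → Carrier) xs ys → ∑ f (xs ++ ys) ≈ ∑ f xs + ∑ f ys
    ∑-++ f []       ys = sym (+-identityˡ _)
    ∑-++ f (x ∷ xs) ys = trans (+-congˡ (∑-++ f xs ys)) (sym (+-assoc _ _ _))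

    ∑-↭ : ∀ (f : A → Carrier) {xs ys} → xs ↭ ys → ∑ f xs ≈ ∑ f ys
    ∑-↭ f Perm.refl        = refl
    ∑-↭ f (prep x p)       = +-congˡ (∑-↭ f p)
    ∑-↭ f (swap x y p)     = trans (+-congˡ (+-congˡ (∑-↭ f p)))
      (solve 3 (λ a b c → a :+ (b :+ c) := b :+ (a :+ c)) refl _ _ _)
    ∑-↭ f (Perm.trans p q) = trans (∑-↭ f p) (∑-↭ f q)

    ∑-zero : ∀ (xs : List A) → ∑ (λ _ → 0#) xs ≈ 0#
    ∑-zero []       = refl
    ∑-zero (x ∷ xs) = trans (+-identityˡ _) (∑-zero xs)

    ∑-filterᵇ : ∀ (f : A → Carrier) p xs → ∑ f (filterᵇ p xs) ≈ ∑ (λ x → f x when p x) xs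
    ∑-filterᵇ f p []       = refl
    ∑-filterᵇ f p (x ∷ xs) with p x
    ... | true  = +-congˡ (∑-filterᵇ f p xs)
    ... | false = trans (∑-filterᵇ f p xs) (sym (+-identityˡ _))

    ∑-when : ∀ b (f : A → Carrier) xs → ∑ (λ x → f x when b) xs ≈ (∑ f xs when b)
    ∑-when true  f xs = refl
    ∑-when false f xs = ∑-zero xs

  ∑-map : ∀ {a b} {A : Set a} {B : Set b} (f : B → Carrier) (g : A → B) xs → ∑ f (map g xs) ≈ ∑ (f ∘ g) xs
  ∑-map f g xs = reflexive (≡.cong sumR (≡.sym (map-∘ xs)))

  ∑-concatMap : ∀ {a b} {A : Set a} {B : Set b} (f : B → Carrier) (g : A → List B) xs →
    ∑ f (concatMap g xs) ≈ ∑ (λ x → ∑ f (g x)) xs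
  ∑-concatMap f g []       = refl
  ∑-concatMap f g (x ∷ xs) = trans (∑-++ f (g x) (concatMap g xs)) (+-congˡ (∑-concatMap f g xs))

  module _ {n : ℕ} where
    open Arrangements R (Fin n)

    ∑-Σpick : ∀ xs (f : Fin n → Carrier) → ∑ f xs ≈ Σpick xs (λ x _ → f x)
    ∑-Σpick []       f = refl
    ∑-Σpick (x ∷ xs) f = +-congˡ (∑-Σpick xs f)

    ∑-avoids : ∀ x ys (f : Fin n → Carrier) → All (x ≢_) ys →
      ∑ (λ y → f y when not (does (x Fin.≟ y))) ys ≈ ∑ f ys
    ∑-avoids x []       f []       = refl
    ∑-avoids x (y ∷ ys) f (p ∷ ps) =
      +-cong (reflexive (≡.cong (λ b → f y when not b) (dec-false (x Fin.≟ y) p))) (∑-avoids x ys f ps)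

    -- As `B` has no duplicates, every position rejects exactly one letter of the alphabet, so the
    -- condition on the word can be traded for the smaller alphabet `ys`.
    ∑-words-avoids : ∀ k x {ys B} (f : List (Fin n) → Carrier) → Unique B → x ∷ ys ↭ B →
      ∑ (λ v → f v when avoidsᵇ x v) (words k B) ≈ ∑ f (words k ys)
    ∑-words-avoids zero    x         f uniq p = refl
    ∑-words-avoids (suc k) x {ys} {B} f uniq p = begin
      ∑ (λ v → f v when avoidsᵇ x v) (words (suc k) B)
        ≈⟨ ∑-concatMap _ (λ y → map (y ∷_) (words k B)) B ⟩
      ∑ (λ y → ∑ (λ v → f v when avoidsᵇ x v) (map (y ∷_) (words k B))) B
        ≈⟨ ∑-cong B (λ y → trans (∑-map _ (y ∷_) (words k B)) (trans
             (∑-cong (words k B) (λ v → when-∧ (not (does (x Fin.≟ y))) (avoidsᵇ x v) _))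
             (trans (∑-when (not (does (x Fin.≟ y))) _ (words k B))
               (when-cong (not (does (x Fin.≟ y))) (∑-words-avoids k x (λ v → f (y ∷ v)) uniq p))))) ⟩
      ∑ (λ y → h y when not (does (x Fin.≟ y))) B
        ≈⟨ ∑-↭ _ p ⟨
      (h x when not (does (x Fin.≟ x))) + ∑ (λ y → h y when not (does (x Fin.≟ y))) ys
        ≈⟨ +-cong (reflexive (≡.cong (λ b → h x when not b) (dec-true (x Fin.≟ x) ≡.refl)))
             (∑-avoids x ys h (AllPairs.head (Unique-↭ p uniq))) ⟩
      0# + ∑ h ys
        ≈⟨ +-identityˡ _ ⟩
      ∑ h ys
        ≈⟨ ∑-cong ys (λ y → ∑-map f (y ∷_) (words k ys)) ⟨
      ∑ (λ y → ∑ f (map (y ∷_) (words k ys))) ys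
        ≈⟨ ∑-concatMap f (λ y → map (y ∷_) (words k ys)) ys ⟨
      ∑ f (words (suc k) ys) ∎
      where
      h : Fin n → Carrier
      h y = ∑ (λ v → f (y ∷ v)) (words k ys)

    ∑-distinct-words : ∀ k B (f : List (Fin n) → Carrier) → Unique B →
      ∑ (λ v → f v when distinctᵇ v) (words k B) ≈ Σarr k B f
    ∑-distinct-words zero    B f uniq = +-identityʳ _
    ∑-distinct-words (suc k) B f uniq = begin
      ∑ (λ v → f v when distinctᵇ v) (words (suc k) B)
        ≈⟨ ∑-concatMap _ (λ x → map (x ∷_) (words k B)) B ⟩
      ∑ (λ x → ∑ (λ v → f v when distinctᵇ v) (map (x ∷_) (words k B))) B
        ≈⟨ ∑-Σpick B _ ⟩
      Σpick B (λ x _ → ∑ (λ v → f v when distinctᵇ v) (map (x ∷_) (words k B)))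
        ≈⟨ Σpick-cong-↭ B (λ x ys p → begin
          ∑ (λ v → f v when distinctᵇ v) (map (x ∷_) (words k B))
            ≈⟨ ∑-map _ (x ∷_) (words k B) ⟩
          ∑ (λ v → f (x ∷ v) when distinctᵇ (x ∷ v)) (words k B)
            ≈⟨ ∑-cong (words k B) (λ v → trans (reflexive (≡.cong (f (x ∷ v) when_) (distinctᵇ-∷ x v)))
                 (when-∧ (avoidsᵇ x v) (distinctᵇ v) _)) ⟩
          ∑ (λ v → (f (x ∷ v) when distinctᵇ v) when avoidsᵇ x v) (words k B)
            ≈⟨ ∑-words-avoids k x _ uniq p ⟩
          ∑ (λ v → f (x ∷ v) when distinctᵇ v) (words k ys)
            ≈⟨ ∑-distinct-words k ys (λ v → f (x ∷ v)) (AllPairs.tail (Unique-↭ p uniq)) ⟩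
          Σarr k ys (λ v → f (x ∷ v)) ∎) ⟩
      Σarr (suc k) B f ∎

    ∑-Perms : ∀ (F : (Fin n → Fin n) → Carrier) (G : List (Fin n) → Carrier) → Unique (allFin n) →
      (∀ σ → F σ ≈ G (tabulate σ)) → ∑ F (Perms n) ≈ Σarr n (allFin n) G
    ∑-Perms F G uniq h = begin
      ∑ F (Perms n)                                            ≈⟨ ∑-cong (Perms n) h ⟩
      ∑ (G ∘ tabulate) (Perms n)                               ≈⟨ ∑-map G tabulate (Perms n) ⟨
      ∑ G (map tabulate (Perms n))                             ≡⟨ ≡.cong (∑ G) Perms-words ⟩
      ∑ G (filterᵇ distinctᵇ (words n (allFin n)))             ≈⟨ ∑-filterᵇ G distinctᵇ (words n (allFin n)) ⟩
      ∑ (λ v → G v when distinctᵇ v) (words n (allFin n))      ≈⟨ ∑-distinct-words n (allFin n) G uniq ⟩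
      Σarr n (allFin n) G                                       ∎

module SplitWords {c ℓ : Level} (R : CommutativeRing c ℓ) {e : Level} (E : Set e) where
  open CommutativeRing R
  open Arrangements R E
  open SetoidReasoning setoid

  -- `P` pairs position k with position m + k, whereas the induction reads neighbouring letters as
  -- pairs. Inserting the second letter drawn at the start of the second half reconciles the two
  -- readings, one pair at a time.
  Σarr-halves : ∀ m xs (h : List E → List E → Carrier) →
    Σarr (m ℕ.+ m) xs (λ v → h (take m v) (drop m v)) ≈ Σarr (double m) xs (λ v → h (evens v) (odds v))
  Σarr-halves zero    xs h = refl
  Σarr-halves (suc m) xs h = begin
    Σpick xs (λ p ys → Σarr (m ℕ.+ suc m) ys (λ v → h (p ∷ take m v) (drop m v)))
      ≡⟨ ≡.cong (λ k → Σpick xs (λ p ys → Σarr k ys (λ v → h (p ∷ take m v) (drop m v)))) (ℕ.+-suc m m) ⟩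
    Σpick xs (λ p ys → Σarr (suc (m ℕ.+ m)) ys (λ v → h (p ∷ take m v) (drop m v)))
      ≈⟨ Σpick-cong xs (λ p ys → trans
           (sym (Σarr-insertAt m (m ℕ.+ m) ys (λ v → h (p ∷ take m v) (drop m v))))
           (Σpick-cong ys (λ q zs → trans
             (Σarr-cong-length (m ℕ.+ m) zs (λ v len → reflexive (≡.cong₂ (λ P Q → h (p ∷ P) Q)
               (take-insertAt m q v (≡.subst (m ℕ.≤_) (≡.sym len) (ℕ.m≤m+n m m)))
               (drop-insertAt m q v (≡.subst (m ℕ.≤_) (≡.sym len) (ℕ.m≤m+n m m))))))
             (Σarr-halves m zs (λ P Q → h (p ∷ P) (q ∷ Q)))))) ⟩
    Σarr (double (suc m)) xs (λ v → h (evens v) (odds v)) ∎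

-- Matchings in standard form

<ᵇ-true : ∀ {m n} → m ℕ.< n → (m <ᵇ n) ≡ true
<ᵇ-true {m} {n} m<n with m <ᵇ n | ℕ.<⇒<ᵇ m<n
... | true | _ = ≡.refl

<ᵇ-false : ∀ {m n} → ¬ m ℕ.< n → (m <ᵇ n) ≡ false
<ᵇ-false {m} {n} m≮n with m <ᵇ n | ℕ.<ᵇ⇒< m n
... | true  | f = ⊥-elim (m≮n (f _))
... | false | _ = ≡.refl

module _ {n : ℕ} where
  private
    lt : Fin n × Fin n → Bool
    lt p = toℕ (proj₁ p) <ᵇ toℕ (proj₂ p)

    and-lt-true : ∀ {x : Fin n} {xs} → All (x Fin.<_) xs → and (map lt (map (x ,_) xs)) ≡ true
    and-lt-true []       = ≡.refl
    and-lt-true (p ∷ ps) = ≡.cong₂ _∧_ (<ᵇ-true p) (and-lt-true ps)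

    and-lt-All : ∀ {x : Fin n} xs → T (and (map lt (map (x ,_) xs))) → All (x Fin.<_) xs
    and-lt-All []       _ = []
    and-lt-All {x} (y ∷ xs) t with p , q ← Equivalence.to (T-∧ {toℕ x <ᵇ toℕ y}) t =
      ℕ.<ᵇ⇒< (toℕ x) (toℕ y) p ∷ and-lt-All xs q

    and-pairs-∷ : ∀ (x : Fin n) xs →
      and (map lt (pairs (x ∷ xs))) ≡ and (map lt (map (x ,_) xs)) ∧ and (map lt (pairs xs))
    and-pairs-∷ x xs = ≡.trans (≡.cong and (map-++ lt (map (x ,_) xs) (pairs xs)))
      (and-++ (map lt (map (x ,_) xs)) (map lt (pairs xs)))

    <-zip : ∀ {x : Fin n} k (v : List (Fin n)) → length v ≡ double k → All (x Fin.<_) (evens v) →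
      T (and (zipWith (λ y z → toℕ y <ᵇ toℕ z) (evens v) (odds v))) → All (x Fin.<_) (odds v)
    <-zip zero    []          eq []       t = []
    <-zip (suc k) (y ∷ z ∷ v) eq (p ∷ ps) t with r , s ← Equivalence.to (T-∧ {toℕ y <ᵇ toℕ z}) t =
      ℕ.<-trans p (ℕ.<ᵇ⇒< (toℕ y) (toℕ z) r) ∷ <-zip k v (ℕ.suc-injective (ℕ.suc-injective eq)) ps s

  isMatchingᵇ-∷∷ : ∀ {x y : Fin n} {v} → x Fin.< y → All (x Fin.<_) v → isMatchingᵇ (x ∷ y ∷ v) ≡ isMatchingᵇ v
  isMatchingᵇ-∷∷ {x} {y} {v} x<y x<v = ≡.cong₂ _∧_
    (≡.cong (_∧ and (zipWith (λ y z → toℕ y <ᵇ toℕ z) (evens v) (odds v))) (<ᵇ-true x<y))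
    (≡.trans (and-pairs-∷ x (evens v)) (≡.cong (_∧ and (map lt (pairs (evens v)))) (and-lt-true
      (All.++⁻ˡ (evens v) (All-resp-↭ (↭-sym (evens-odds-↭ v)) x<v)))))

  -- The first entries increase and each second entry exceeds its partner, so every letter lies
  -- above the head.
  isMatchingᵇ⇒head-min : ∀ k (x : Fin n) v → length v ≡ suc (double k) →
    T (isMatchingᵇ (x ∷ v)) → All (x Fin.<_) v
  isMatchingᵇ⇒head-min k x (y ∷ v) eq t
    with t₁ , t₂ ← Equivalence.to (T-∧ {and (zipWith (λ y z → toℕ y <ᵇ toℕ z) (x ∷ evens v) (y ∷ odds v))}) t
    with x<y , t₃ ← Equivalence.to (T-∧ {toℕ x <ᵇ toℕ y}) t₁
    with t₄ , _ ← Equivalence.to (T-∧ {and (map lt (map (x ,_) (evens v)))}) (≡.subst T (and-pairs-∷ x (evens v)) t₂) =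
    ℕ.<ᵇ⇒< (toℕ x) (toℕ y) x<y ∷
      All-resp-↭ (evens-odds-↭ v) (All.++⁺ x<evens (<-zip k v (ℕ.suc-injective eq) x<evens t₃))
    where
    x<evens = and-lt-All (evens v) t₄

  isMatchingᵇ-false : ∀ k (x : Fin n) {v} {y : Fin n} {ys} → length v ≡ suc (double k) → v ↭ y ∷ ys → y Fin.< x →
    isMatchingᵇ (x ∷ v) ≡ false
  isMatchingᵇ-false k x {v} eq p y<x with isMatchingᵇ (x ∷ v) | isMatchingᵇ⇒head-min k x v eq
  ... | false | _ = ≡.refl
  ... | true  | f = ⊥-elim (ℕ.<-asym y<x (All.head (All-resp-↭ p (f _))))

-- Alternating products and signs

module Signs {c ℓ : Level} (R : CommutativeRing c ℓ) (n : ℕ) where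
  open CommutativeRing R
  open RingDefs R using (prodR; fromℕR; negOnePow)
  open IntegerSolver R
  open FiniteSums R
  open Arrangements R (Fin n)
  open PlückerFamilies R (Fin n)
  open Factorisation R (Fin n)
  open SetoidReasoning setoid

  -- An analogue of the Vandermonde product, with the factors oriented by the order of the letters
  -- in the word.
  Δ : (Fin n → Fin n → Carrier) → List (Fin n) → Carrier
  Δ F v = ∏ (uncurry F) (pairs v)

  Δ-∷ : ∀ F x v → Δ F (x ∷ v) ≈ ∏ (F x) v * Δ F v
  Δ-∷ F x v = trans (∏-++ (uncurry F) (map (x ,_) v) (pairs v))
    (*-congʳ (reflexive (≡.cong prodR (≡.sym (map-∘ v)))))

  ∏-cong-All : ∀ {f g : Fin n → Carrier} {v} → All (λ x → f x ≈ g x) v → ∏ f v ≈ ∏ g v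
  ∏-cong-All []       = refl
  ∏-cong-All (p ∷ ps) = *-cong p (∏-cong-All ps)

  Δ-cong-AllPairs : ∀ {F G : Fin n → Fin n → Carrier} {v} → AllPairs (λ x y → F x y ≈ G x y) v → Δ F v ≈ Δ G v
  Δ-cong-AllPairs []       = refl
  Δ-cong-AllPairs {F} {G} {x ∷ v} (p ∷ ps) = trans (Δ-∷ F x v)
    (trans (*-cong (∏-cong-All p) (Δ-cong-AllPairs ps)) (sym (Δ-∷ G x v)))

  Δ-↭ : ∀ {F : Fin n → Fin n → Carrier} → (∀ x y → F x y ≈ F y x) → ∀ {u v} → u ↭ v → Δ F u ≈ Δ F v
  Δ-↭ s Perm.refl = refl
  Δ-↭ {F} s (prep {u} {v} x p) = trans (Δ-∷ F x u)
    (trans (*-cong (∏-↭ (F x) p) (Δ-↭ s p)) (sym (Δ-∷ F x v)))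
  Δ-↭ {F} s (swap {u} {v} x y p) = begin
    Δ F (x ∷ y ∷ u)                             ≈⟨ trans (Δ-∷ F x (y ∷ u)) (*-congˡ (Δ-∷ F y u)) ⟩
    (F x y * ∏ (F x) u) * (∏ (F y) u * Δ F u)   ≈⟨ *-cong (*-cong (s x y) (∏-↭ (F x) p)) (*-cong (∏-↭ (F y) p) (Δ-↭ s p)) ⟩
    (F y x * ∏ (F x) v) * (∏ (F y) v * Δ F v)   ≈⟨ solve 4 (λ f a b d → (f :* a) :* (b :* d) := (f :* b) :* (a :* d)) refl _ _ _ _ ⟩
    (F y x * ∏ (F y) v) * (∏ (F x) v * Δ F v)   ≈⟨ trans (Δ-∷ F y (x ∷ v)) (*-congˡ (Δ-∷ F x v)) ⟨
    Δ F (y ∷ x ∷ v)                             ∎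
  Δ-↭ s (Perm.trans p q) = trans (Δ-↭ s p) (Δ-↭ s q)

  Δ-++ : ∀ F u v → Δ F (u ++ v) ≈ Δ F u * Δ F v * cross F u v
  Δ-++ F []      v = sym (trans (*-identityʳ _) (*-identityˡ _))
  Δ-++ F (x ∷ u) v = begin
    Δ F (x ∷ u ++ v)
      ≈⟨ trans (Δ-∷ F x (u ++ v)) (*-cong (∏-++ (F x) u v) (Δ-++ F u v)) ⟩
    (∏ (F x) u * ∏ (F x) v) * (Δ F u * Δ F v * cross F u v)
      ≈⟨ solve 5 (λ a b c d e → (a :* b) :* (c :* d :* e) := (a :* c) :* d :* (b :* e)) refl _ _ _ _ _ ⟩
    (∏ (F x) u * Δ F u) * Δ F v * (∏ (F x) v * cross F u v)
      ≈⟨ *-congʳ (*-congʳ (Δ-∷ F x u)) ⟨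
    Δ F (x ∷ u) * Δ F v * cross F (x ∷ u) v ∎

  Δ-inverse : ∀ {z w : Fin n → Fin n → Carrier} → (∀ i j → i ≢ j → z i j * w i j ≈ 1#) →
    ∀ {v} → Unique v → Δ w v * Δ z v ≈ 1#
  Δ-inverse inv []       = *-identityˡ _
  Δ-inverse {z} {w} inv {x ∷ v} (p ∷ ps) = trans (*-cong (Δ-∷ w x v) (Δ-∷ z x v)) (trans
    (solve 4 (λ a b c d → (a :* b) :* (c :* d) := (a :* c) :* (b :* d)) refl _ _ _ _)
    (trans (*-cong (trans (sym (∏-* v (w x) (z x))) (trans (∏-cong-All (All.map (λ {y} x≢y →
        trans (*-comm _ _) (inv x y x≢y)) p)) (∏-one v))) (Δ-inverse inv ps))
      (*-identityˡ _)))
    where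
    ∏-one : ∀ (v : List (Fin n)) → ∏ (λ _ → 1#) v ≈ 1#
    ∏-one []      = refl
    ∏-one (_ ∷ v) = trans (*-identityˡ _) (∏-one v)

  signOf : List (Fin n) → Carrier
  signOf v = negOnePow (descents v)

  private
    descent : Fin n × Fin n → Bool
    descent p = toℕ (proj₂ p) <ᵇ toℕ (proj₁ p)

    -- Evaluating with the smaller index first gives a symmetric function, whose `Δ` ignores the
    -- order of the word; for antisymmetric `F` every descent then accounts for exactly one sign.
    unsigned : (Fin n → Fin n → Carrier) → Fin n → Fin n → Carrier
    unsigned F x y = if toℕ y <ᵇ toℕ x then F y x else F x y

    unsigned-sym : ∀ F x y → (unsigned F) x y ≈ (unsigned F) y x
    unsigned-sym F x y with ℕ.<-cmp (toℕ x) (toℕ y)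
    ... | tri< x<y _ y≮x rewrite <ᵇ-true x<y | <ᵇ-false y≮x = refl
    ... | tri> x≮y _ y<x rewrite <ᵇ-false x≮y | <ᵇ-true y<x = refl
    ... | tri≈ _ x≡y _ rewrite Fin.toℕ-injective x≡y = refl

    sign-split : ∀ {F} → Antisymmetric F → ∀ ps →
      ∏ (uncurry F) ps ≈ negOnePow (length (filterᵇ descent ps)) * ∏ (uncurry (unsigned F)) ps
    sign-split anti []             = sym (*-identityˡ _)
    sign-split anti ((x , y) ∷ ps) with toℕ y <ᵇ toℕ x
    ... | true  = trans (*-cong (Antisymmetric.antisym anti x y) (sign-split anti ps))
      (solve 3 (λ f e p → :- f :* (e :* p) := :- e :* (f :* p)) refl _ _ _)
    ... | false = trans (*-congˡ (sign-split anti ps))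
      (solve 3 (λ f e p → f :* (e :* p) := e :* (f :* p)) refl _ _ _)

  Δ-sign : ∀ {F} → Antisymmetric F → ∀ {v B} → AllPairs Fin._<_ B → v ↭ B → Δ F v ≈ signOf v * Δ F B
  Δ-sign {F} anti {v} {B} sorted p = trans (sign-split anti (pairs v)) (*-congˡ (trans
    (Δ-↭ (unsigned-sym F) p)
    (Δ-cong-AllPairs (AllPairs.map (λ {x} {y} x<y →
      reflexive (≡.cong (λ b → if b then F y x else F x y) (<ᵇ-false (ℕ.<-asym x<y)))) sorted))))

  -- Since `Δ` is alternating, the sign is the quotient of its values on the sorted list and on `v`.
  -- In this form signs cancel against products of `z`.
  signOf-Δ : ∀ {z w : Fin n → Fin n → Carrier} → Antisymmetric w → (∀ i j → i ≢ j → z i j * w i j ≈ 1#) →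
    ∀ {v B} → AllPairs Fin._<_ B → v ↭ B → signOf v ≈ Δ w v * Δ z B
  signOf-Δ {z} {w} anti inv {v} {B} sorted p = sym (trans (*-congʳ (Δ-sign anti sorted p)) (trans (*-assoc _ _ _)
    (trans (*-congˡ (Δ-inverse inv (AllPairs.map (λ x<y x≡y → ℕ.<-irrefl (≡.cong toℕ x≡y) x<y) sorted))) (*-identityʳ _))))

  zipProd : (Fin n → Fin n → Carrier) → List (Fin n) → List (Fin n) → Carrier
  zipProd F u v = prodR (zipWith F u v)

  zipProd-cong : ∀ {F G : Fin n → Fin n → Carrier} {u v} → All (λ x → All (λ y → F x y ≈ G x y) v) u →
    zipProd F u v ≈ zipProd G u v
  zipProd-cong {u = []}              _        = refl
  zipProd-cong {u = _ ∷ _} {[]}      _        = refl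
  zipProd-cong {u = x ∷ u} {y ∷ v} (p ∷ ps) = *-cong (All.head p) (zipProd-cong (All.map All.tail ps))

  zipProd-pairProd : ∀ F k v → length v ≡ double k → zipProd F (evens v) (odds v) ≈ pairProd F v
  zipProd-pairProd F zero    []          eq = refl
  zipProd-pairProd F (suc k) (p ∷ q ∷ v) eq =
    *-congˡ (zipProd-pairProd F k v (ℕ.suc-injective (ℕ.suc-injective eq)))

  module Matchings {z w : Fin n → Fin n → Carrier} (plᶻ : Plücker z) (antiʷ : Antisymmetric w)
                   (inv : ∀ i j → i ≢ j → z i j * w i j ≈ 1#) (a b : Fin n → Fin n → Carrier) where
    open Poles plᶻ antiʷ inv

    matchingTerm : List (Fin n) → Carrier
    matchingTerm v = Δ w v * zipProd (λ i j → a i j * b i j * w i j) (evens v) (odds v) when isMatchingᵇ v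

    -- Standard form forces the smallest index into first place, so words with any other first
    -- letter contribute zero. Only the partner of the smallest index is free, and the remaining
    -- list is again sorted.
    Σarr-matchings : ∀ k B → length B ≡ double k → AllPairs Fin._<_ B → Σarr (double k) B matchingTerm ≈ Q a b k B
    Σarr-matchings zero    []      eq sorted = *-identityˡ _
    Σarr-matchings (suc k) (x ∷ N) eq (x<N ∷ sorted) = trans
      (+-cong
        (Σpick-cong-AllPairs sorted (λ y ys p s → trans
          (Σarr-cong-↭ (double k) ys (len p) (λ v q → first-pair y ys v p q))
          (trans (Σarr-*ˡ _ (double k) ys matchingTerm) (*-congˡ (Σarr-matchings k ys (len p) s)))))
        (trans (Σpick-cong-↭ N {G = λ _ _ → 0#} (λ y ys p → trans
            (Σarr-cong-↭ (suc (double k)) (x ∷ ys) (≡.trans (↭-length p) (ℕ.suc-injective eq)) (λ v q →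
              reflexive (≡.cong (F (y ∷ v) when_)
                (isMatchingᵇ-false k y (≡.trans (↭-length q) (≡.trans (↭-length p) (ℕ.suc-injective eq))) q
                  (All.head (All-resp-↭ (↭-sym p) x<N))))))
            (Σarr-zero (suc (double k)) (x ∷ ys) (λ _ → refl))))
          (Σpick-zero N (λ _ _ → refl))))
      (+-identityʳ _)
      where
      F : List (Fin n) → Carrier
      F v = Δ w v * zipProd (λ i j → a i j * b i j * w i j) (evens v) (odds v)
      len : ∀ {y ys} → y ∷ ys ↭ N → length ys ≡ double k
      len p = ℕ.suc-injective (≡.trans (↭-length p) (ℕ.suc-injective eq))
      first-pair : ∀ y ys v → y ∷ ys ↭ N → v ↭ ys → matchingTerm (x ∷ y ∷ v) ≈
        (a x y * b x y * w x y) * (∏ (w x) (y ∷ ys) * ∏ (w y) ys) * matchingTerm v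
      first-pair y ys v p q = begin
        F (x ∷ y ∷ v) when isMatchingᵇ (x ∷ y ∷ v)
          ≡⟨ ≡.cong (F (x ∷ y ∷ v) when_) (isMatchingᵇ-∷∷ (All.head x<y∷v) (All.tail x<y∷v)) ⟩
        F (x ∷ y ∷ v) when isMatchingᵇ v
          ≈⟨ when-cong (isMatchingᵇ v) (trans
               (*-congʳ (trans (Δ-∷ w x (y ∷ v)) (*-cong (*-congˡ (∏-↭ (w x) q))
                 (trans (Δ-∷ w y v) (*-congʳ (∏-↭ (w y) q))))))
               (solve 5 (λ wx wy d g s → (wx :* (wy :* d)) :* (g :* s) := (g :* (wx :* wy)) :* (d :* s)) refl _ _ _ _ _)) ⟩
        (a x y * b x y * w x y) * (∏ (w x) (y ∷ ys) * ∏ (w y) ys) * F v when isMatchingᵇ v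
          ≈⟨ when-*ˡ (isMatchingᵇ v) _ (F v) ⟩
        (a x y * b x y * w x y) * (∏ (w x) (y ∷ ys) * ∏ (w y) ys) * matchingTerm v ∎
        where
        x<y∷v : All (x Fin.<_) (y ∷ v)
        x<y∷v = All-resp-↭ (↭-sym (↭-trans (prep y q) p)) x<N

-- The constant d

-- The quotient is the ballot number C(2m,m) - C(2m,m+1).
ballot-divides : ∀ m → m ! ℕ.* suc m ! ∣ (m ℕ.+ m) !
ballot-divides zero    = 1∣ 1
ballot-divides (suc k) = subtract
  (k![n∸k]!∣n! {m ℕ.+ m} {m} (ℕ.m≤m+n m m))
  (k![n∸k]!∣n! {m ℕ.+ m} {suc m} (ℕ.≤-trans (ℕ.s≤s (ℕ.m≤m+n m k)) (ℕ.≤-reflexive (≡.sym (ℕ.+-suc m k)))))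
  where
  open ≡.≡-Reasoning
  open ℕ-Solver.+-*-Solver
  m = suc k
  2m∸[1+m]≡k : (m ℕ.+ m) ℕ.∸ suc m ≡ k
  2m∸[1+m]≡k = ≡.trans (≡.cong (ℕ._∸ suc m) (ℕ.+-suc m k)) (ℕ.m+n∸m≡n m k)
  subtract : m ! ℕ.* (m ℕ.+ m ℕ.∸ m) ! ∣ (m ℕ.+ m) ! → suc m ! ℕ.* (m ℕ.+ m ℕ.∸ suc m) ! ∣ (m ℕ.+ m) ! →
    m ! ℕ.* suc m ! ∣ (m ℕ.+ m) !
  subtract (divides q eq-q) (divides r eq-r) = divides (q ℕ.∸ r) (≡.sym (begin
    (q ℕ.∸ r) ℕ.* (m ! ℕ.* suc m !)
      ≡⟨ ℕ.*-distribʳ-∸ (m ! ℕ.* suc m !) q r ⟩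
    q ℕ.* (m ! ℕ.* suc m !) ℕ.∸ r ℕ.* (m ! ℕ.* suc m !)
      -- Here `q` and `r` are the two binomial coefficients. Against their denominators m! m! and
      -- (m+1)! (m-1)!, the product m! (m+1)! has an extra factor m + 1 and m respectively.
      ≡⟨ ≡.cong₂ ℕ._∸_
           (solve 3 (λ q f m → q :* (f :* (m :* f)) := m :* (q :* (f :* f))) ≡.refl q (m !) (suc m))
           (solve 4 (λ r m f g → r :* (m :* f :* g) := m :* (r :* (g :* f))) ≡.refl r m (k !) (suc m !)) ⟩
    suc m ℕ.* (q ℕ.* (m ! ℕ.* m !)) ℕ.∸ m ℕ.* (r ℕ.* (suc m ! ℕ.* k !))
      ≡⟨ ≡.cong₂ (λ x y → suc m ℕ.* x ℕ.∸ m ℕ.* y)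
           (≡.trans (≡.cong (λ x → q ℕ.* (m ! ℕ.* x !)) (≡.sym (ℕ.m+n∸m≡n m m))) (≡.sym eq-q))
           (≡.trans (≡.cong (λ x → r ℕ.* (suc m ! ℕ.* x !)) (≡.sym 2m∸[1+m]≡k)) (≡.sym eq-r)) ⟩
    suc m ℕ.* (m ℕ.+ m) ! ℕ.∸ m ℕ.* (m ℕ.+ m) !
      ≡⟨ ℕ.m+n∸n≡m ((m ℕ.+ m) !) (m ℕ.* (m ℕ.+ m) !) ⟩
    (m ℕ.+ m) ! ∎))

dSYT-* : ∀ m → dSYT m ℕ.* (m ! ℕ.* suc m !) ≡ (m ℕ.+ m) !
dSYT-* m = m/n*n≡m {{ℕ._!*_!≢0 m (suc m)}} (ballot-divides m)

-- Extending the Plücker relations to coinciding indices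

module OffDiagonal {c ℓ : Level} (R : CommutativeRing c ℓ) (n : ℕ) where
  open CommutativeRing R
  open RingDefs R
  open IntegerSolver R
  open PlückerFamilies R (Fin n)
  open SetoidReasoning setoid

  -- IsPlücker leaves the diagonal unconstrained; with zeros there, the relations hold for all indices.
  offDiagonal : (Fin n → Fin n → Carrier) → Fin n → Fin n → Carrier
  offDiagonal x i j = if does (i Fin.≟ j) then 0# else x i j

  offDiagonal-≢ : ∀ x {i j} → i ≢ j → offDiagonal x i j ≈ x i j
  offDiagonal-≢ x {i} {j} i≢j = reflexive (≡.cong (if_then 0# else x i j) (dec-false (i Fin.≟ j) i≢j))

  offDiagonal-≡ : ∀ x i → offDiagonal x i i ≈ 0#
  offDiagonal-≡ x i = reflexive (≡.cong (if_then 0# else x i i) (dec-true (i Fin.≟ i) ≡.refl))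

  module _ {x : Fin n → Fin n → Carrier} where
    offDiagonal-Antisymmetric : (∀ i j → i ≢ j → x i j ≈ - x j i) → Antisymmetric (offDiagonal x)
    offDiagonal-Antisymmetric h = record { antisym = antisym ; diag = offDiagonal-≡ x }
      where
      antisym : ∀ i j → offDiagonal x i j ≈ - offDiagonal x j i
      antisym i j with i Fin.≟ j
      ... | yes ≡.refl = trans (solve 0 (con (ℤ.+ 0) := :- con (ℤ.+ 0)) refl) (-‿cong (sym (offDiagonal-≡ x i)))
      ... | no  i≢j    = trans (h i j i≢j) (-‿cong (sym (offDiagonal-≢ x (≡.≢-sym i≢j))))

    -- If two of the indices coincide, one of the three products contains a diagonal entry and the
    -- other two cancel, where necessary after an antisymmetry.
    offDiagonal-Plücker : IsPlücker x → Plücker (offDiagonal x)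
    offDiagonal-Plücker pl = record
      { antisymmetric = anti
      ; three-term = λ i j k l →
          three-term i j k l (i Fin.≟ j) (i Fin.≟ k) (i Fin.≟ l) (j Fin.≟ k) (j Fin.≟ l) (k Fin.≟ l)
      }
      where
      anti = offDiagonal-Antisymmetric (IsPlücker.antisym pl)
      open Antisymmetric anti
      X = offDiagonal x
      three-term : ∀ i j k l → Dec (i ≡ j) → Dec (i ≡ k) → Dec (i ≡ l) → Dec (j ≡ k) → Dec (j ≡ l) → Dec (k ≡ l) →
        X i j * X k l + - (X i k * X j l) + X j k * X i l ≈ 0#
      three-term i i k l (yes ≡.refl) _ _ _ _ _ =
        trans (+-congʳ (+-congʳ (*-congʳ (diag i))))
          (solve 3 (λ a b c → con (ℤ.+ 0) :* a :+ :- (b :* c) :+ b :* c := con (ℤ.+ 0)) refl (X k l) (X i k) (X i l))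
      three-term i j i l (no _) (yes ≡.refl) _ _ _ _ =
        trans (+-cong (+-congˡ (-‿cong (*-congʳ (diag i)))) (*-congʳ (antisym j i)))
          (solve 3 (λ a b c → a :* b :+ :- (con (ℤ.+ 0) :* c) :+ :- a :* b := con (ℤ.+ 0)) refl (X i j) (X i l) (X j l))
      three-term i j k i (no _) (no _) (yes ≡.refl) _ _ _ =
        trans (+-cong (+-cong (*-congˡ (antisym k i)) (-‿cong (*-congˡ (antisym j i)))) (*-congˡ (diag i)))
          (solve 3 (λ a b c → a :* :- b :+ :- (b :* :- a) :+ c :* con (ℤ.+ 0) := con (ℤ.+ 0)) refl (X i j) (X i k) (X j k))
      three-term i j j l (no _) (no _) (no _) (yes ≡.refl) _ _ =
        trans (+-congˡ (*-congʳ (diag j)))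
          (solve 3 (λ a b c → a :* b :+ :- (a :* b) :+ con (ℤ.+ 0) :* c := con (ℤ.+ 0)) refl (X i j) (X j l) (X i l))
      three-term i j k j (no _) (no _) (no _) (no _) (yes ≡.refl) _ =
        trans (+-cong (+-cong (*-congˡ (antisym k j)) (-‿cong (*-congˡ (diag j)))) refl)
          (solve 3 (λ a b c → a :* :- b :+ :- (c :* con (ℤ.+ 0)) :+ b :* a := con (ℤ.+ 0)) refl (X i j) (X j k) (X i k))
      three-term i j k k (no _) (no _) (no _) (no _) (no _) (yes ≡.refl) =
        trans (+-congʳ (+-congʳ (*-congˡ (diag k))))
          (solve 3 (λ a b c → a :* con (ℤ.+ 0) :+ :- (b :* c) :+ c :* b := con (ℤ.+ 0)) refl (X i j) (X i k) (X j k))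
      three-term i j k l (no i≢j) (no i≢k) (no i≢l) (no j≢k) (no j≢l) (no k≢l) = trans
        (+-cong (+-cong (*-cong (≢ i≢j) (≢ k≢l)) (-‿cong (*-cong (≢ i≢k) (≢ j≢l)))) (*-cong (≢ j≢k) (≢ i≢l)))
        (IsPlücker.plücker pl i j k l i≢j i≢k i≢l j≢k j≢l k≢l)
        where
        ≢ : ∀ {i j} → i ≢ j → X i j ≈ x i j
        ≢ = offDiagonal-≢ x

  inverse-antisym : ∀ (z w : Fin n → Fin n → Carrier) → (∀ i j → i ≢ j → z i j ≈ - z j i) → (∀ i j → i ≢ j → z i j * w i j ≈ 1#) →
    ∀ i j → i ≢ j → w i j ≈ - w j i
  inverse-antisym z w anti inv i j i≢j = begin
    w i j                          ≈⟨ *-identityʳ _ ⟨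
    w i j * 1#                     ≈⟨ *-congˡ (inv j i (≡.≢-sym i≢j)) ⟨
    w i j * (z j i * w j i)        ≈⟨ *-congˡ (*-congʳ (anti j i (≡.≢-sym i≢j))) ⟩
    w i j * (- z i j * w j i)      ≈⟨ solve 3 (λ w z v → w :* (:- z :* v) := (z :* w) :* :- v) refl _ _ _ ⟩
    (z i j * w i j) * - w j i      ≈⟨ trans (*-congʳ (inv i j i≢j)) (*-identityˡ _) ⟩
    - w j i                        ∎

-- Factorials in the ring, and assembly of the identity

module NaturalNumbers {c ℓ : Level} (R : CommutativeRing c ℓ) where
  open CommutativeRing R
  open RingDefs R
  open SetoidReasoning setoid

  fromℕR-+ : ∀ m n → fromℕR (m ℕ.+ n) ≈ fromℕR m + fromℕR n
  fromℕR-+ zero    n = sym (+-identityˡ _)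
  fromℕR-+ (suc m) n = trans (+-congˡ (fromℕR-+ m n)) (sym (+-assoc _ _ _))

  fromℕR-* : ∀ m n → fromℕR (m ℕ.* n) ≈ fromℕR m * fromℕR n
  fromℕR-* zero    n = sym (zeroˡ _)
  fromℕR-* (suc m) n = trans (fromℕR-+ n (m ℕ.* n)) (trans
    (+-cong (sym (*-identityˡ _)) (fromℕR-* m n)) (sym (distribʳ _ _ _)))

  coefficient-factorials : ∀ {e} (E : Set e) k → Factorisation.coefficient R E k ≈ fromℕR (k ! ℕ.* suc k !)
  coefficient-factorials E zero    = sym (+-identityʳ _)
  coefficient-factorials E (suc k) = begin
    fromℕR (suc k) * fromℕR (suc (suc k)) * Factorisation.coefficient R E k
      ≈⟨ *-cong (sym (fromℕR-* (suc k) (suc (suc k)))) (coefficient-factorials E k) ⟩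
    fromℕR (suc k ℕ.* suc (suc k)) * fromℕR (k ! ℕ.* suc k !)
      ≈⟨ fromℕR-* (suc k ℕ.* suc (suc k)) (k ! ℕ.* suc k !) ⟨
    fromℕR (suc k ℕ.* suc (suc k) ℕ.* (k ! ℕ.* suc k !))
      ≡⟨ ≡.cong fromℕR (solve 4 (λ a b f g → a :* b :* (f :* g) := a :* f :* (b :* g)) ≡.refl (suc k) (suc (suc k)) (k !) (suc k !)) ⟩
    fromℕR (suc k ! ℕ.* suc (suc k) !) ∎
    where open ℕ-Solver.+-*-Solver

module PfaffianFactorisation {c ℓ : Level} (R : CommutativeRing c ℓ) (m : ℕ) where
  open CommutativeRing R
  open RingDefs R

  private
    n = m ℕ.+ m
    B = allFin n

  open IntegerSolver R
  open FiniteSums R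
  open Arrangements R (Fin n)
  open PlückerFamilies R (Fin n)
  open Factorisation R (Fin n)
  open SplitWords R (Fin n)
  open Signs R n
  open OffDiagonal R n
  open NaturalNumbers R
  open SetoidReasoning setoid

  sorted : AllPairs Fin._<_ B
  sorted = AllPairs.tabulate⁺-< id

  unique : Unique B
  unique = AllPairs.map (λ x<y x≡y → ℕ.<-irrefl (≡.cong toℕ x≡y) x<y) sorted

  m+m≡double : ∀ k → k ℕ.+ k ≡ double k
  m+m≡double zero    = ≡.refl
  m+m≡double (suc k) = ≡.cong suc (≡.trans (ℕ.+-suc k k) (≡.cong suc (m+m≡double k)))

  module _ {z zInv : Fin n → Fin n → Carrier} (plᶻ : IsPlücker z) (inv : ∀ i j → i ≢ j → z i j * zInv i j ≈ 1#) where
    ẑ ŵ : Fin n → Fin n → Carrier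
    ẑ = offDiagonal z
    ŵ = offDiagonal zInv

    plẑ : Plücker ẑ
    plẑ = offDiagonal-Plücker plᶻ

    antiŵ : Antisymmetric ŵ
    antiŵ = offDiagonal-Antisymmetric (inverse-antisym z zInv (IsPlücker.antisym plᶻ) inv)

    inv̂ : ∀ i j → i ≢ j → ẑ i j * ŵ i j ≈ 1#
    inv̂ i j i≢j = trans (*-cong (offDiagonal-≢ z i≢j) (offDiagonal-≢ zInv i≢j)) (inv i j i≢j)

    open Poles plẑ antiŵ inv̂

    Δ-offDiagonal : ∀ x {v} → Unique v → Δ x v ≈ Δ (offDiagonal x) v
    Δ-offDiagonal x u = Δ-cong-AllPairs {F = x} {offDiagonal x} (AllPairs.map (λ i≢j → sym (offDiagonal-≢ x i≢j)) u)

    ∏-pairsLt : ∀ {k} (F : Fin n → Fin n → Carrier) (f : Fin k → Fin n) →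
      prodR (map (λ p → F (f (proj₁ p)) (f (proj₂ p))) (pairsLt k)) ≡ Δ F (tabulate f)
    ∏-pairsLt F f = ≡.cong prodR (≡.trans (map-∘ (pairsLt _)) (≡.cong (map (uncurry F)) (pairsLt-tabulate f)))

    ∇-summand : (Fin n → Fin n → Carrier) → List (Fin n) → Carrier
    ∇-summand x v = signOf v * (zipProd x (take m v) (drop m v) * Δ z (take m v) * Δ z (drop m v))

    ∇-summand-tabulate : ∀ x σ →
      sgn σ * P m (λ i j → x (σ i) (σ j)) (λ i j → z (σ i) (σ j)) ≡ ∇-summand x (tabulate σ)
    ∇-summand-tabulate x σ = ≡.cong₂ _*_ (≡.cong negOnePow (inversions-tabulate σ))
      (≡.cong₂ _*_ (≡.cong₂ _*_
        (≡.trans (≡.cong prodR (≡.sym (zipWith-tabulate x (λ k → σ (k ↑ˡ m)) (λ k → σ (m ↑ʳ k)))))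
          (≡.cong₂ (zipProd x) (≡.sym (take-tabulate m σ)) (≡.sym (drop-tabulate m σ))))
        (≡.trans (∏-pairsLt z (λ k → σ (k ↑ˡ m))) (≡.cong (Δ z) (≡.sym (take-tabulate m σ)))))
        (≡.trans (∏-pairsLt z (λ k → σ (m ↑ʳ k))) (≡.cong (Δ z) (≡.sym (drop-tabulate m σ)))))

    -- With the sign written as a quotient of alternating products, `Δ ŵ v` splits along the two
    -- halves of the word. The part inside each half cancels the corresponding product of `z` in
    -- `P`, and only the poles between the halves survive.
    ∇-summand-↭ : ∀ x v → v ↭ B →
      ∇-summand x v ≈ Δ ẑ B * (zipProd (offDiagonal x) (take m v) (drop m v) * cross ŵ (take m v) (drop m v))
    ∇-summand-↭ x v p = begin
      signOf v * (zipProd x U V * Δ z U * Δ z V)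
        ≈⟨ *-cong (trans (signOf-Δ antiŵ inv̂ sorted p) (*-congʳ (trans
               (reflexive (≡.cong (Δ ŵ) (≡.sym (take++drop≡id m v)))) (Δ-++ ŵ U V))))
             (*-cong (*-cong (zipProd-cong {x} {offDiagonal x} (All.map (All.map (λ i≢j → sym (offDiagonal-≢ x i≢j))) U≢V))
               (Δ-offDiagonal z uU)) (Δ-offDiagonal z uV)) ⟩
      (Δ ŵ U * Δ ŵ V * C * D) * (A * Δ ẑ U * Δ ẑ V)
        ≈⟨ solve 7 (λ a b c d e f g → (a :* b :* c :* d) :* (e :* f :* g) := (d :* (e :* c)) :* ((a :* f) :* (b :* g))) refl _ _ _ _ _ _ _ ⟩
      (D * (A * C)) * ((Δ ŵ U * Δ ẑ U) * (Δ ŵ V * Δ ẑ V))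
        ≈⟨ *-congˡ (*-cong (Δ-inverse inv̂ uU) (Δ-inverse inv̂ uV)) ⟩
      (D * (A * C)) * (1# * 1#)
        ≈⟨ trans (*-congˡ (*-identityˡ _)) (*-identityʳ _) ⟩
      D * (A * C) ∎
      where
      U = take m v
      V = drop m v
      C = cross ŵ U V
      D = Δ ẑ B
      A = zipProd (offDiagonal x) U V
      uUV : Unique (U ++ V)
      uUV = ≡.subst Unique (≡.sym (take++drop≡id m v)) (Unique-↭ p unique)
      uU : Unique U
      uU = AllPairs-++⁻ˡ U uUV
      uV : Unique V
      uV = AllPairs.drop⁺ m (Unique-↭ p unique)
      U≢V : All (λ x → All (x ≢_) V) U
      U≢V = go U uUV
        where
        go : ∀ U → Unique (U ++ V) → All (λ x → All (x ≢_) V) U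
        go []      _        = []
        go (x ∷ U) (q ∷ qs) = All.++⁻ʳ U q ∷ go U qs

    ∇-S : ∀ nInv x → ∇ nInv (P m) x z ≈ nInv * (Δ ẑ B * S (offDiagonal x) m B)
    ∇-S nInv x = *-congˡ (begin
      ∑ (λ σ → sgn σ * P m (λ i j → x (σ i) (σ j)) (λ i j → z (σ i) (σ j))) (Perms n)
        ≈⟨ ∑-Perms _ (∇-summand x) unique (λ σ → reflexive (∇-summand-tabulate x σ)) ⟩
      Σarr n B (∇-summand x)
        ≈⟨ Σarr-cong-↭ n B (length-tabulate id) (∇-summand-↭ x) ⟩
      Σarr n B (λ v → Δ ẑ B * h (take m v) (drop m v))
        ≈⟨ Σarr-*ˡ (Δ ẑ B) n B _ ⟩
      Δ ẑ B * Σarr n B (λ v → h (take m v) (drop m v))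
        ≈⟨ *-congˡ (trans (Σarr-halves m B h) (Σarr-cong-length (double m) B (λ v len →
             *-congʳ (zipProd-pairProd (offDiagonal x) m v len)))) ⟩
      Δ ẑ B * S (offDiagonal x) m B ∎)
      where
      h : List (Fin n) → List (Fin n) → Carrier
      h U V = zipProd (offDiagonal x) U V * cross ŵ U V

    module _ (a b : Fin n → Fin n → Carrier) where
      open Matchings plẑ antiŵ inv̂ (offDiagonal a) (offDiagonal b)

      private
        A Â : Fin n → Fin n → Carrier
        A i j = if does (i Fin.≟ j) then 0# else a i j * b i j * zInv i j
        Â i j = offDiagonal a i j * offDiagonal b i j * ŵ i j

        A≈Â : ∀ i j → A i j ≈ Â i j
        A≈Â i j with does (i Fin.≟ j)
        ... | true  = solve 0 (con (ℤ.+ 0) := con (ℤ.+ 0) :* con (ℤ.+ 0) :* con (ℤ.+ 0)) refl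
        ... | false = refl

        Pf-summand : List (Fin n) → Carrier
        Pf-summand v = signOf v * zipProd A (evens v) (odds v) when isMatchingᵇ v

        zipProd-A : ∀ u v → zipProd A u v ≈ zipProd Â u v
        zipProd-A u v = zipProd-cong {A} {Â} {u = u} (All.universal (λ x → All.universal (λ y → A≈Â x y) v) u)

      Pf-Q : Pf m A ≈ Δ ẑ B * Q (offDiagonal a) (offDiagonal b) m B
      Pf-Q = begin
        Pf m A
          ≈⟨ ∑-filterᵇ _ (isMatchingPerm m) (Perms n) ⟩
        ∑ (λ σ → sgn σ * prodR (map (λ k → A (σ (evenPos k)) (σ (oddPos k))) (allFin m)) when isMatchingPerm m σ) (Perms n)
          ≈⟨ ∑-Perms _ Pf-summand unique (λ σ → reflexive (≡.cong₂ _when_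
               (≡.cong₂ _*_ (≡.cong negOnePow (inversions-tabulate σ))
                 (≡.trans (≡.cong prodR (≡.sym (zipWith-tabulate A (σ ∘ evenPos {m}) (σ ∘ oddPos))))
                   (≡.cong₂ (zipProd A) (tabulate-evenPos m σ) (tabulate-oddPos m σ))))
               (isMatchingPerm-tabulate m σ))) ⟩
        Σarr n B Pf-summand
          ≈⟨ Σarr-cong-↭ n B (length-tabulate id) (λ v p → trans
               (when-cong (isMatchingᵇ v) (trans (*-cong (trans (signOf-Δ antiŵ inv̂ sorted p) (*-comm _ _)) (zipProd-A (evens v) (odds v)))
                 (*-assoc _ _ _)))
               (when-*ˡ (isMatchingᵇ v) _ _)) ⟩
        Σarr n B (λ v → Δ ẑ B * matchingTerm v)
          ≈⟨ Σarr-*ˡ (Δ ẑ B) n B matchingTerm ⟩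
        Δ ẑ B * Σarr n B matchingTerm
          ≡⟨ ≡.cong (λ k → Δ ẑ B * Σarr k B matchingTerm) (m+m≡double m) ⟩
        Δ ẑ B * Σarr (double m) B matchingTerm
          ≈⟨ *-congˡ (Σarr-matchings m B (≡.trans (length-tabulate id) (m+m≡double m)) sorted) ⟩
        Δ ẑ B * Q (offDiagonal a) (offDiagonal b) m B ∎

      Pf-factorisation : IsPlücker a → IsPlücker b → ∀ nInv → fromℕR (n !) * nInv ≈ 1# →
        Pf m A ≈ fromℕR (dSYT m) * fromℕR (dSYT m) * prodR (map (λ p → zInv (proj₁ p) (proj₂ p)) (pairsLt n))
          * (∇ nInv (P m) a z * ∇ nInv (P m) b z)
      Pf-factorisation plᵃ plᵇ nInv n!inv = sym (begin
        d * d * prodR (map (λ p → zInv (proj₁ p) (proj₂ p)) (pairsLt n)) * (∇ nInv (P m) a z * ∇ nInv (P m) b z)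
          ≈⟨ *-cong (*-congˡ (trans (reflexive (∏-pairsLt zInv id)) (Δ-offDiagonal zInv unique))) (*-cong (∇-S nInv a) (∇-S nInv b)) ⟩
        d * d * Δ ŵ B * ((nInv * (D * S (offDiagonal a) m B)) * (nInv * (D * S (offDiagonal b) m B)))
          -- Each antisymmetriser supplies one `D`. The product of the `zInv` cancels one of them,
          -- and the other converts `q` into the Pfaffian.
          ≈⟨ solve 6 (λ d w n D s t → d :* d :* w :* ((n :* (D :* s)) :* (n :* (D :* t))) :=
               (d :* n) :* (d :* n) :* (w :* D) :* D :* (s :* t)) refl _ _ _ _ _ _ ⟩
        (d * nInv) * (d * nInv) * (Δ ŵ B * D) * D * (S (offDiagonal a) m B * S (offDiagonal b) m B)
          ≈⟨ *-cong (*-congʳ (trans (*-congˡ (Δ-inverse inv̂ unique)) (*-identityʳ _)))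
               (sym (Q-factorises (offDiagonal-Plücker plᵃ) (offDiagonal-Plücker plᵇ) m B
                 (≡.trans (length-tabulate id) (m+m≡double m)) unique)) ⟩
        (d * nInv) * (d * nInv) * D * (κ * κ * q)
          ≈⟨ solve 5 (λ d n D k q → (d :* n) :* (d :* n) :* D :* (k :* k :* q) := ((d :* k) :* n) :* ((d :* k) :* n) :* (D :* q)) refl _ _ _ _ _ ⟩
        ((d * κ) * nInv) * ((d * κ) * nInv) * (D * q)
          ≈⟨ *-congʳ (trans (*-cong dκn dκn) (*-identityˡ _)) ⟩
        1# * (D * q)
          ≈⟨ *-identityˡ _ ⟩
        D * q
          ≈⟨ Pf-Q ⟨
        Pf m A ∎)
        where
        d = fromℕR (dSYT m)
        D = Δ ẑ B
        κ = coefficient m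
        q = Q (offDiagonal a) (offDiagonal b) m B
        -- The coefficient `κ` is m! (m+1)!, the denominator of d, so `d * κ` is (2m)!, which `nInv`
        -- inverts.
        dκn : (d * κ) * nInv ≈ 1#
        dκn = trans (*-congʳ (begin
          d * κ                                          ≈⟨ *-congˡ (coefficient-factorials (Fin n) m) ⟩
          d * fromℕR (m ! ℕ.* suc m !)                   ≈⟨ fromℕR-* (dSYT m) _ ⟨
          fromℕR (dSYT m ℕ.* (m ! ℕ.* suc m !))          ≡⟨ ≡.cong fromℕR (dSYT-* m) ⟩
          fromℕR (n !)                                   ∎)) n!inv

theorem2 : ∀ {c ℓ : Level} (R : CommutativeRing c ℓ) (m : ℕ) → 1 ≤ m →
    let open CommutativeRing R
        open RingDefs R
    in (a b z zInv : Fin (m ℕ.+ m) → Fin (m ℕ.+ m) → Carrier) (nInv : Carrier) →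
    IsPlücker a → IsPlücker b → IsPlücker z →
    (∀ i j → ¬ (i ≡ j) → z i j * zInv i j ≈ 1#) →
    fromℕR ((m ℕ.+ m) !) * nInv ≈ 1# →
    Pf m (λ i j → if does (i Data.Fin.≟ j) then 0# else a i j * b i j * zInv i j)
    ≈ fromℕR (dSYT m) * fromℕR (dSYT m)
    * prodR (map (λ p → zInv (proj₁ p) (proj₂ p)) (pairsLt (m ℕ.+ m)))
    * (∇ nInv (P m) a z * ∇ nInv (P m) b z)
theorem2 R m _ a b z zInv nInv plᵃ plᵇ plᶻ inv n!inv =
  PfaffianFactorisation.Pf-factorisation R m plᶻ inv a b plᵃ plᵇ nInv n!inv
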